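{- There is an absolute constant $c>0$ such that the following holds for every integer $n$ and every $\varepsilon\in(1/\sqrt n,1)$. Let $\mathrm{sk}$ and $\mathrm{est}$ be (possibly randomized) sketching and estimation algorithms for unweighted graphs on vertex set $[n]$. Suppose that for every such graph $G=([n],E)$, with probability at least $3/4$ (over the randomness of the two algorithms) we have $$\forall S\subset[n],\qquad \mathrm{est}(S,\mathrm{sk}(G))\in(1\pm\varepsilon)\cdot|\partial(S,\bar S)| .$$ Then the worst-case size of $\mathrm{sk}(G)$ is at least $c\,n/\varepsilon^2$ bits.
   Context: Graphs are undirected. For $S\subset[n]$, $\bar S=[n]\setminus S$ and $\partial(S,\bar S)=\{(u,v)\in E: u\in S, v\in\bar S\}$. The sketching algorithm maps a graph $G$ to a bit string $\mathrm{sk}(G)$; the estimation algorithm maps a query $S$ and a bit string to a real number, with no further access to $G$. The two algorithms have access to a common source of random bits. The worst-case size is the maximum length of $\mathrm{sk}(G)$ over all graphs $G$ on $[n]$ and all random choices. The notation $X\in(1\pm\varepsilon)Y$ means $(1-\varepsilon)Y\le X\le(1+\varepsilon)Y$. -}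

module Defs where

open import Data.Bool using (Bool; true; false)
import Data.Bool.Properties as Bool
open import Data.Fin using (Fin)
open import Data.Fin.Subset using (Subset; _∈_; ∁)
open import Data.Fin.Subset.Properties using (_∈?_)
open import Data.Integer using (+_)
open import Data.List using (List; []; _∷_; length; filter; cartesianProduct; allFin)
open import Data.Nat as ℕ using (ℕ; zero; suc)
import Data.Nat.Properties as ℕ
open import Data.Product using (∃; _×_; _,_; proj₁; proj₂)
open import Data.Rational
open import Data.Rational.Properties
open import Data.Rational.Solver using (module +-*-Solver)
open import Data.Unit using (⊤)
open import Function using (_∘_)
open import Relation.Binary.PropositionalEquality
open import Relation.Nullary using (¬_)
open import Relation.Nullary.Decidable using (_×-dec_)

-- Real numbers, as Cauchy sequences of rationals.  Equality of reals is the
-- equivalence relation "x ≤ℝ y and y ≤ℝ x", not _≡_.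

IsCauchy : (ℕ → ℚ) → Set
IsCauchy x = ∀ δ → 0ℚ < δ →
  ∃ λ N → ∀ m k → N ℕ.≤ m → N ℕ.≤ k → ∣ x m - x k ∣ ≤ δ

record ℝ : Set where
  constructor mkℝ
  field
    seq    : ℕ → ℚ
    cauchy : IsCauchy seq

open ℝ public

infix 4 _≤ℝ_ _<ℝ_

_≤ℝ_ : ℝ → ℝ → Set
x ≤ℝ y = ∀ δ → 0ℚ < δ → ∃ λ N → ∀ m → N ℕ.≤ m → seq x m ≤ seq y m + δ

_<ℝ_ : ℝ → ℝ → Set
x <ℝ y = ∃ λ δ → (0ℚ < δ) × ∃ λ N → ∀ m → N ℕ.≤ m → seq x m + δ ≤ seq y m

fromℚ : ℚ → ℝ
fromℚ q = mkℝ (λ _ → q) λ δ 0<δ →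
  0 , λ _ _ _ _ → subst (λ z → ∣ z ∣ ≤ δ) (sym (+-inverseʳ q)) (<⇒≤ 0<δ)

fromℕ : ℕ → ℝ
fromℕ n = fromℚ (+ n / 1)

0ℝ 1ℝ : ℝ
0ℝ = fromℚ 0ℚ
1ℝ = fromℚ 1ℚ

private
  0<½* : ∀ {δ} → 0ℚ < δ → 0ℚ < ½ * δ
  0<½* {δ} 0<δ = subst (_< ½ * δ) (*-zeroʳ ½) (*-monoʳ-<-pos ½ 0<δ)

  halves : ∀ δ → ½ * δ + ½ * δ ≡ δ
  halves δ = trans (sym (*-distribʳ-+ δ ½ ½)) (*-identityˡ δ)

  split : ∀ a b {δ α β} → α + β ≡ δ → ∣ a ∣ ≤ α → ∣ b ∣ ≤ β → ∣ a + b ∣ ≤ δ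
  split a b eq p q =
    ≤-trans (∣p+q∣≤∣p∣+∣q∣ a b) (subst (∣ a ∣ + ∣ b ∣ ≤_) eq (+-mono-≤ p q))

  +-cauchy : ∀ x y → IsCauchy x → IsCauchy y → IsCauchy (λ m → x m + y m)
  +-cauchy x y cx cy δ 0<δ =
    let N , p = cx (½ * δ) (0<½* 0<δ)
        M , q = cy (½ * δ) (0<½* 0<δ)
    in N ℕ.⊔ M , λ m k l r →
      subst (λ z → ∣ z ∣ ≤ δ) (rearrange (x m) (y m) (x k) (y k))
        (split (x m - x k) (y m - y k) (halves δ)
          (p m k (ℕ.m⊔n≤o⇒m≤o N M l) (ℕ.m⊔n≤o⇒m≤o N M r))
          (q m k (ℕ.m⊔n≤o⇒n≤o N M l) (ℕ.m⊔n≤o⇒n≤o N M r)))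
    where
    rearrange : ∀ a b c d → (a - c) + (b - d) ≡ (a + b) - (c + d)
    rearrange = solve 4 (λ a b c d →
      (a :- c) :+ (b :- d) := (a :+ b) :- (c :+ d)) refl
      where open +-*-Solver

  neg-cauchy : ∀ x → IsCauchy x → IsCauchy (λ m → - x m)
  neg-cauchy x cx δ 0<δ =
    let N , p = cx δ 0<δ
    in N , λ m k l r →
      subst (_≤ δ)
        (trans (sym (∣-p∣≡∣p∣ (x m - x k))) (cong ∣_∣ (neg-distrib-+ (x m) (- x k))))
        (p m k l r)

  bounded : ∀ x → IsCauchy x →
            ∃ λ B → Positive B × ∃ λ N → ∀ m → N ℕ.≤ m → ∣ x m ∣ ≤ B
  bounded x cx =
    let N , p = cx 1ℚ (positive⁻¹ 1ℚ)
    in (∣ x N ∣ + 1ℚ) ,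
       nonNeg+pos⇒pos (∣ x N ∣) {{∣-∣-nonNeg (x N)}} 1ℚ ,
       N , λ m l → subst (λ z → ∣ z ∣ ≤ ∣ x N ∣ + 1ℚ) (back (x N) (x m))
                     (split (x N) (x m - x N) refl ≤-refl (p m N l ℕ.≤-refl))
    where
    back : ∀ a b → a + (b - a) ≡ b
    back = solve 2 (λ a b → a :+ (b :- a) := b) refl
      where open +-*-Solver

  *-bound : ∀ a b {B δ} → .{{NonNegative B}} → ∣ a ∣ ≤ B → ∣ b ∣ ≤ δ → ∣ a * b ∣ ≤ B * δ
  *-bound a b {B} {δ} p q =
    subst (_≤ B * δ) (sym (∣p*q∣≡∣p∣*∣q∣ a b))
      (≤-trans (*-monoʳ-≤-nonNeg ∣ b ∣ {{∣-∣-nonNeg b}} p) (*-monoˡ-≤-nonNeg B q))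

  divide : ∀ S → Positive S → ∀ δ → 0ℚ < δ → ∃ λ η → (0ℚ < η) × (S * η ≡ δ)
  divide S S>0 δ 0<δ = 1/ S * δ , 0<η , eq
    where
    instance
      S-pos : Positive S
      S-pos = S>0
      S-nonZero : NonZero S
      S-nonZero = pos⇒nonZero S
      1/S-pos : Positive (1/ S)
      1/S-pos = 1/pos⇒pos S

    0<η : 0ℚ < 1/ S * δ
    0<η = subst (_< 1/ S * δ) (*-zeroʳ (1/ S)) (*-monoʳ-<-pos (1/ S) 0<δ)

    eq : S * (1/ S * δ) ≡ δ
    eq = trans (sym (*-assoc S (1/ S) δ))
           (trans (cong (_* δ) (*-inverseʳ S)) (*-identityˡ δ))

  *-cauchy : ∀ x y → IsCauchy x → IsCauchy y → IsCauchy (λ m → x m * y m)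
  *-cauchy x y cx cy δ 0<δ =
    let A , A>0 , K , boundx = bounded x cx
        B , B>0 , L , boundy = bounded y cy
        η , 0<η , total = divide (A + B) (pos+pos⇒pos A {{A>0}} B {{B>0}}) δ 0<δ
        N , p = cx η 0<η
        M , q = cy η 0<η
    in (K ℕ.⊔ L) ℕ.⊔ (N ℕ.⊔ M) , λ m k l r →
      let kl : ∀ {i} → (K ℕ.⊔ L) ℕ.⊔ (N ℕ.⊔ M) ℕ.≤ i → K ℕ.⊔ L ℕ.≤ i
          kl = ℕ.m⊔n≤o⇒m≤o (K ℕ.⊔ L) (N ℕ.⊔ M)
          nm : ∀ {i} → (K ℕ.⊔ L) ℕ.⊔ (N ℕ.⊔ M) ℕ.≤ i → N ℕ.⊔ M ℕ.≤ i
          nm = ℕ.m⊔n≤o⇒n≤o (K ℕ.⊔ L) (N ℕ.⊔ M)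
      in subst (λ z → ∣ z ∣ ≤ δ) (rearrange (x m) (y m) (x k) (y k))
        (split (x m * (y m - y k)) (y k * (x m - x k))
          (trans (sym (*-distribʳ-+ η A B)) total)
          (*-bound (x m) (y m - y k) {{pos⇒nonNeg A {{A>0}}}}
            (boundx m (ℕ.m⊔n≤o⇒m≤o K L (kl l)))
            (q m k (ℕ.m⊔n≤o⇒n≤o N M (nm l)) (ℕ.m⊔n≤o⇒n≤o N M (nm r))))
          (*-bound (y k) (x m - x k) {{pos⇒nonNeg B {{B>0}}}}
            (boundy k (ℕ.m⊔n≤o⇒n≤o K L (kl r)))
            (p m k (ℕ.m⊔n≤o⇒m≤o N M (nm l)) (ℕ.m⊔n≤o⇒m≤o N M (nm r)))))
    where
    rearrange : ∀ a b c d → a * (b - d) + d * (a - c) ≡ a * b - c * d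
    rearrange = solve 4 (λ a b c d →
      a :* (b :- d) :+ d :* (a :- c) := a :* b :- c :* d) refl
      where open +-*-Solver

infixl 6 _+ℝ_ _-ℝ_
infixl 7 _*ℝ_

_+ℝ_ _-ℝ_ _*ℝ_ : ℝ → ℝ → ℝ
x +ℝ y = mkℝ (λ m → seq x m + seq y m)
             (+-cauchy (seq x) (seq y) (cauchy x) (cauchy y))
x -ℝ y = mkℝ (λ m → seq x m - seq y m)
             (+-cauchy (seq x) (λ m → - seq y m) (cauchy x) (neg-cauchy (seq y) (cauchy y)))
x *ℝ y = mkℝ (λ m → seq x m * seq y m)
             (*-cauchy (seq x) (seq y) (cauchy x) (cauchy y))

infix 4 _∈[1±_]*_

_∈[1±_]*_ : ℝ → ℝ → ℝ → Set
X ∈[1± ε ]* Y = ((1ℝ -ℝ ε) *ℝ Y ≤ℝ X) × (X ≤ℝ (1ℝ +ℝ ε) *ℝ Y)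

record Graph (n : ℕ) : Set where
  field
    adj    : Fin n → Fin n → Bool
    symm   : ∀ u v → adj u v ≡ adj v u
    irrefl : ∀ v → adj v v ≡ false

open Graph public

-- For disjoint S and T an undirected edge between S and T is listed exactly
-- once, oriented from S to T.

∂ : ∀ {n} → Graph n → Subset n → Subset n → List (Fin n × Fin n)
∂ {n} G S T = filter
  (λ (u , v) → (u ∈? S) ×-dec (v ∈? T) ×-dec (adj G u v Bool.≟ true))
  (cartesianProduct (allFin n) (allFin n))

cutSize : ∀ {n} → Graph n → Subset n → ℕ
cutSize G S = length (∂ G S (∁ S))

BitString : Set
BitString = List Bool

Coins : Set
Coins = ℕ → Bool

_isPrefixOf_ : BitString → Coins → Set
[]      isPrefixOf ω = ⊤
(b ∷ w) isPrefixOf ω = (b ≡ ω 0) × (w isPrefixOf (ω ∘ suc))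

-- 2^(-|w|), the measure of the cylinder of all ω with prefix w.

cylinderMeasure : BitString → ℚ
cylinderMeasure []      = 1ℚ
cylinderMeasure (_ ∷ w) = ½ * cylinderMeasure w

partialSum : (ℕ → BitString) → ℕ → ℚ
partialSum U zero    = 0ℚ
partialSum U (suc k) = partialSum U k + cylinderMeasure (U k)

-- A has Lebesgue (fair-coin) measure at least p: for every δ > 0 the
-- complement of A can be covered by a sequence of cylinders of total measure
-- at most 1 - p + δ, that is, its outer measure is at most 1 - p.  For
-- non-measurable A this is a bound on the inner measure.  Classically a
-- bounded series of nonnegative terms converges, so the IsCauchy clause is
-- automatic; constructively it makes the total measure of the cover a real
-- number, without which even a cover of small measure could contain every
-- computable ω.

Probability≥ : ℚ → (Coins → Set) → Set
Probability≥ p A = ∀ δ → 0ℚ < δ →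
  ∃ λ (U : ℕ → BitString) →
    IsCauchy (partialSum U)
    × (∀ k → partialSum U k ≤ (1ℚ - p) + δ)
    × (∀ ω → (∀ i → ¬ (U i isPrefixOf ω)) → A ω)

-- Both algorithms are run on the same ω; private
-- randomness is covered by reading disjoint parts of ω.

SketchAlg : ℕ → Set
SketchAlg n = Coins → Graph n → BitString

EstimateAlg : ℕ → Set
EstimateAlg n = Coins → Subset n → BitString → ℝ

ApproximatesAllCuts : ∀ {n} → SketchAlg n → EstimateAlg n → ℝ → Graph n → Coins → Set
ApproximatesAllCuts {n} sk est ε G ω =
  ∀ (S : Subset n) → est ω S (sk ω G) ∈[1± ε ]* fromℕ (cutSize G S)

-- The worst-case size is the least s with this property.

WorstCaseSize≤ : ∀ {n} → SketchAlg n → ℕ → Set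
WorstCaseSize≤ {n} sk s = ∀ (G : Graph n) (ω : Coins) → length (sk ω G) ℕ.≤ s

{-# OPTIONS --safe #-}

-- For bipartite graphs with parts of size d = q² and n − d, the edges encode
-- N = d (n − d) bits.  If two such graphs share a sketch, all their cuts agree
-- up to O(ε N).  On the other hand, a signed sum of k entries ±1 has expected
-- absolute value of order √k, so two graphs at Hamming distance h have a cut on
-- which they differ by at least about h / √d = h / q.  With q a small multiple
-- of 1/ε this forces h ≤ N / 8, so the graphs sharing a sketch lie in a Hamming
-- ball of exponentially small density, and s ≥ cN = Ω(n q²) follows by counting.
-- When ε is not small, stars (d = 1) are used, whose cuts at single leaves
-- separate any two of them.  The coins are fixed by the method of conditional
-- expectations, reading the covers of the failure events bit by bit.

module Submission where

-- For each graph the hypothesis supplies only a sequence of cylinders covering the failure event,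
-- so one cannot simply average over ω. An explicit ω is computed instead, chosen so that the covers
-- of at most 3/8 of the graphs contain it; the Cauchy clause is what makes each coin computable.
-- Whether ω lies in a given cover remains undecidable, but the counting bound is an inequality
-- between natural numbers and hence stable under double negation, so a classical case split over
-- the finitely many graphs is harmless. The lower bound on signed sums is derandomised too. For
-- integer q the inequality 16 q³ |z| ≥ 12 q² z² - z⁴ bounds |z| below by moments that are known
-- exactly. The expectation over signs thus becomes an integer potential that a greedy choice of
-- signs, one row at a time, keeps from falling. No square root occurs, because d is taken to be a
-- perfect square.

-- Counting on the Boolean cube.

module Cube where

  open import Defs using (BitString)
  open import Data.Bool using (Bool; true; false; not; _∧_; _xor_; if_then_else_)
  open import Data.List using ([]; _∷_; length)
  open import Data.Nat
  open import Data.Nat.Properties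
  open import Data.Product using (∃; _×_; _,_; proj₁; proj₂)
  open import Data.Sum using (_⊎_; inj₁; inj₂)
  open import Data.Vec using (Vec; []; _∷_)
  open import Data.Nat.Tactic.RingSolver using (solve-∀)
  open import Function using (_∘_)
  open import Relation.Binary.PropositionalEquality

  -- Generic in the addition: over ℕ it counts vectors, over ℚ it adds up masses of covers.
  cubeSum : {A : Set} → (A → A → A) → ∀ N → (Vec Bool N → A) → A
  cubeSum _⊕_ zero    f = f []
  cubeSum _⊕_ (suc N) f = cubeSum _⊕_ N (f ∘ (false ∷_)) ⊕ cubeSum _⊕_ N (f ∘ (true ∷_))

  -- One induction for congruence, monotonicity and commutation with additive maps such as `ι` or
  -- multiplication by a constant, according to the choice of `R`.
  cubeSum-rel : ∀ {A B : Set} {_⊕_ : A → A → A} {_⊞_ : B → B → B} (R : A → B → Set) →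
    (∀ {a b c d} → R a b → R c d → R (a ⊕ c) (b ⊞ d)) →
    ∀ N {f g} → (∀ v → R (f v) (g v)) → R (cubeSum _⊕_ N f) (cubeSum _⊞_ N g)
  cubeSum-rel R R-⊕ zero    f~g = f~g []
  cubeSum-rel R R-⊕ (suc N) f~g =
    R-⊕ (cubeSum-rel R R-⊕ N (f~g ∘ (false ∷_))) (cubeSum-rel R R-⊕ N (f~g ∘ (true ∷_)))

  cubeSum-distrib : ∀ {A : Set} (_⊕_ : A → A → A) →
    (∀ a b c d → (a ⊕ b) ⊕ (c ⊕ d) ≡ (a ⊕ c) ⊕ (b ⊕ d)) →
    ∀ N (f g : Vec Bool N → A) →
    cubeSum _⊕_ N (λ v → f v ⊕ g v) ≡ cubeSum _⊕_ N f ⊕ cubeSum _⊕_ N g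
  cubeSum-distrib _⊕_ medial zero    f g = refl
  cubeSum-distrib _⊕_ medial (suc N) f g =
    trans (cong₂ _⊕_ (cubeSum-distrib _⊕_ medial N _ _) (cubeSum-distrib _⊕_ medial N _ _))
          (medial _ _ _ _)

  𝟙 : Bool → ℕ
  𝟙 b = if b then 1 else 0

  count : ∀ {N} → (Vec Bool N → Bool) → ℕ
  count {N} Q = cubeSum _+_ N (𝟙 ∘ Q)

  cubeSum-const : ∀ N c → cubeSum _+_ N (λ _ → c) ≡ 2 ^ N * c
  cubeSum-const zero    c = sym (+-identityʳ c)
  cubeSum-const (suc N) c = trans (cong₂ _+_ ih ih) (double (2 ^ N) c)
    where
    ih = cubeSum-const N c
    double : ∀ m c → m * c + m * c ≡ (m + (m + 0)) * c
    double = solve-∀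

  count-not : ∀ {N} (Q : Vec Bool N → Bool) → count Q + count (not ∘ Q) ≡ 2 ^ N
  count-not {N} Q = begin
    count Q + count (not ∘ Q)                     ≡⟨ cubeSum-distrib _+_ medial N _ _ ⟨
    cubeSum _+_ N (λ v → 𝟙 (Q v) + 𝟙 (not (Q v))) ≡⟨ cubeSum-rel _≡_ (cong₂ _+_) N (λ v → 𝟙-not (Q v)) ⟩
    cubeSum _+_ N (λ _ → 1)                       ≡⟨ cubeSum-const N 1 ⟩
    2 ^ N * 1                                     ≡⟨ *-identityʳ (2 ^ N) ⟩
    2 ^ N                                         ∎
    where
    open ≡-Reasoning
    medial : ∀ a b c d → (a + b) + (c + d) ≡ (a + c) + (b + d)
    medial = solve-∀
    𝟙-not : ∀ b → 𝟙 b + 𝟙 (not b) ≡ 1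
    𝟙-not false = refl
    𝟙-not true  = refl

  count-≤-3 : ∀ {N} (Q Q₀ Q₁ Q₂ : Vec Bool N → Bool) →
    (∀ v → 𝟙 (Q v) ≤ 𝟙 (Q₀ v) + (𝟙 (Q₁ v) + 𝟙 (Q₂ v))) →
    count Q ≤ count Q₀ + (count Q₁ + count Q₂)
  count-≤-3 {N} Q Q₀ Q₁ Q₂ split = begin
    count Q
      ≤⟨ cubeSum-rel _≤_ +-mono-≤ N split ⟩
    cubeSum _+_ N (λ v → 𝟙 (Q₀ v) + (𝟙 (Q₁ v) + 𝟙 (Q₂ v)))
      ≡⟨ cubeSum-distrib _+_ medial N _ _ ⟩
    count Q₀ + cubeSum _+_ N (λ v → 𝟙 (Q₁ v) + 𝟙 (Q₂ v))
      ≡⟨ cong (count Q₀ +_) (cubeSum-distrib _+_ medial N _ _) ⟩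
    count Q₀ + (count Q₁ + count Q₂) ∎
    where
    open ≤-Reasoning
    medial : ∀ a b c d → (a + b) + (c + d) ≡ (a + c) + (b + d)
    medial = solve-∀

  inhabited? : ∀ {N} (Q : Vec Bool N → Bool) → (∃ λ v → Q v ≡ true) ⊎ (∀ v → Q v ≡ false)
  inhabited? {zero} Q with Q [] in eq
  ... | true  = inj₁ ([] , eq)
  ... | false = inj₂ λ { [] → eq }
  inhabited? {suc N} Q with inhabited? (Q ∘ (false ∷_)) | inhabited? (Q ∘ (true ∷_))
  ... | inj₁ (v , p) | _            = inj₁ (_ , p)
  ... | inj₂ _       | inj₁ (v , p) = inj₁ (_ , p)
  ... | inj₂ p       | inj₂ q       = inj₂ λ { (false ∷ v) → p v ; (true ∷ v) → q v }

  hamming : ∀ {N} → Vec Bool N → Vec Bool N → ℕ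
  hamming []      []      = 0
  hamming (a ∷ v) (b ∷ w) = 𝟙 (a xor b) + hamming v w

  -- This is ℓ^(N - hamming v w), written as a product over coordinates so that its sum over the
  -- cube factors as (1 + ℓ)^N.
  weight : ℕ → ∀ {N} → Vec Bool N → Vec Bool N → ℕ
  weight ℓ []          []          = 1
  weight ℓ (true ∷ v)  (true ∷ w)  = ℓ * weight ℓ v w
  weight ℓ (true ∷ v)  (false ∷ w) = weight ℓ v w
  weight ℓ (false ∷ v) (true ∷ w)  = weight ℓ v w
  weight ℓ (false ∷ v) (false ∷ w) = ℓ * weight ℓ v w

  weight-hamming : ∀ ℓ {N} (v w : Vec Bool N) → weight ℓ v w * ℓ ^ hamming v w ≡ ℓ ^ N
  weight-hamming ℓ []          []          = refl
  weight-hamming ℓ (true ∷ v)  (true ∷ w)  = trans (*-assoc ℓ _ _) (cong (ℓ *_) (weight-hamming ℓ v w))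
  weight-hamming ℓ (false ∷ v) (false ∷ w) = trans (*-assoc ℓ _ _) (cong (ℓ *_) (weight-hamming ℓ v w))
  weight-hamming ℓ (true ∷ v)  (false ∷ w) = trans (swap (weight ℓ v w) ℓ _) (cong (ℓ *_) (weight-hamming ℓ v w))
    where
    swap : ∀ a b c → a * (b * c) ≡ b * (a * c)
    swap = solve-∀
  weight-hamming ℓ (false ∷ v) (true ∷ w)  = trans (swap (weight ℓ v w) ℓ _) (cong (ℓ *_) (weight-hamming ℓ v w))
    where
    swap : ∀ a b c → a * (b * c) ≡ b * (a * c)
    swap = solve-∀

  cubeSum-weight : ∀ ℓ {N} (w : Vec Bool N) → cubeSum _+_ N (λ v → weight ℓ v w) ≡ suc ℓ ^ N
  cubeSum-weight ℓ []          = refl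
  cubeSum-weight ℓ {suc N} (true ∷ w)  = cong₂ _+_ (cubeSum-weight ℓ w)
    (cubeSum-rel (λ x y → x ≡ ℓ * y) (λ { refl refl → sym (*-distribˡ-+ ℓ _ _) }) N (λ _ → refl)
      ⟨≡⟩ cong (ℓ *_) (cubeSum-weight ℓ w))
    where _⟨≡⟩_ = trans
  cubeSum-weight ℓ {suc N} (false ∷ w) = trans (cong₂ _+_
    (cubeSum-rel (λ x y → x ≡ ℓ * y) (λ { refl refl → sym (*-distribˡ-+ ℓ _ _) }) N (λ _ → refl)
      ⟨≡⟩ cong (ℓ *_) (cubeSum-weight ℓ w))
    (cubeSum-weight ℓ w)) (+-comm (ℓ * suc ℓ ^ N) _)
    where _⟨≡⟩_ = trans

  -- A Chernoff bound by weights. Any member `w` of `Q` serves as centre: each member then has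
  -- weight at least ℓ^(N - r), while all weights together amount to (1 + ℓ)^N. Multiplying by ℓ^r
  -- avoids the subtraction.
  count-close : ∀ ℓ r {N} → 0 < ℓ → (Q : Vec Bool N → Bool) →
    (∀ v w → Q v ≡ true → Q w ≡ true → hamming v w ≤ r) →
    count Q * ℓ ^ N ≤ suc ℓ ^ N * ℓ ^ r
  count-close ℓ@(suc _) r {N} 0<ℓ Q close with inhabited? Q
  ... | inj₂ empty = ≤-trans (≤-reflexive (cong (_* ℓ ^ N) count≡0)) z≤n
    where
    count≡0 : count Q ≡ 0
    count≡0 = trans (cubeSum-rel _≡_ (cong₂ _+_) N (λ v → cong 𝟙 (empty v)))
                    (trans (cubeSum-const N 0) (*-zeroʳ (2 ^ N)))
  ... | inj₁ (w , Qw) = begin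
    count Q * ℓ ^ N
      ≤⟨ cubeSum-rel (λ x y → x * ℓ ^ N ≤ y * ℓ ^ r)
           (λ {a} {b} {c} {d} p q → ≤-trans (≤-reflexive (*-distribʳ-+ (ℓ ^ N) a c))
              (≤-trans (+-mono-≤ p q) (≤-reflexive (sym (*-distribʳ-+ (ℓ ^ r) b d)))))
           N term ⟩
    cubeSum _+_ N (λ v → weight ℓ v w) * ℓ ^ r
      ≡⟨ cong (_* ℓ ^ r) (cubeSum-weight ℓ w) ⟩
    suc ℓ ^ N * ℓ ^ r ∎
    where
    open ≤-Reasoning
    term : ∀ v → 𝟙 (Q v) * ℓ ^ N ≤ weight ℓ v w * ℓ ^ r
    term v with Q v in eq
    ... | false = z≤n
    ... | true  = begin
      1 * ℓ ^ N                       ≡⟨ *-identityˡ (ℓ ^ N) ⟩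
      ℓ ^ N                           ≡⟨ weight-hamming ℓ v w ⟨
      weight ℓ v w * ℓ ^ hamming v w  ≤⟨ *-monoʳ-≤ (weight ℓ v w) (^-monoʳ-≤ ℓ (close v w eq Qw)) ⟩
      weight ℓ v w * ℓ ^ r            ∎

  -- The number 2^(s+1) - 1 of strings of length at most s, with the recursion that `pigeonhole`
  -- follows: the empty string, then a split on the first bit.
  strings≤ : ℕ → ℕ
  strings≤ zero    = 1
  strings≤ (suc s) = 1 + (strings≤ s + strings≤ s)

  null : BitString → Bool
  null []      = true
  null (_ ∷ _) = false

  startsWith : Bool → BitString → Bool
  startsWith _     []      = false
  startsWith true  (c ∷ _) = c
  startsWith false (c ∷ _) = not c

  tail : BitString → BitString
  tail []      = []
  tail (_ ∷ σ) = σ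

  ∧-true : ∀ {a b} → a ∧ b ≡ true → a ≡ true × b ≡ true
  ∧-true {true} {true} refl = refl , refl

  null-≡ : ∀ {σ τ} → null σ ≡ true → null τ ≡ true → σ ≡ τ
  null-≡ {[]} {[]} _ _ = refl

  startsWith-≡ : ∀ b {σ τ} → startsWith b σ ≡ true → startsWith b τ ≡ true → tail σ ≡ tail τ → σ ≡ τ
  startsWith-≡ true  {true ∷ _}  {true ∷ _}  _ _ refl = refl
  startsWith-≡ false {false ∷ _} {false ∷ _} _ _ refl = refl

  length-tail : ∀ {s} σ → length σ ≤ suc s → length (tail σ) ≤ s
  length-tail []      _       = z≤n
  length-tail (_ ∷ _) (s≤s p) = p

  -- Induction on the length, splitting `Q` by the first bit of `h`. The fibre hypothesis ranges
  -- over all subsets of `Q` on which `h` is constant, so that it passes to the parts, where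
  -- `tail ∘ h` takes the place of `h`. The factor `c` admits fibre bounds that are fractions.
  pigeonhole : ∀ s {N} c B (Q : Vec Bool N → Bool) (h : Vec Bool N → BitString) →
    (∀ v → Q v ≡ true → length (h v) ≤ s) →
    (∀ Q′ → (∀ v → Q′ v ≡ true → Q v ≡ true) →
      (∀ v w → Q′ v ≡ true → Q′ w ≡ true → h v ≡ h w) → count Q′ * c ≤ B) →
    count Q * c ≤ strings≤ s * B
  pigeonhole zero c B Q h short fibre =
    ≤-trans (fibre Q (λ _ q → q) λ v w Qv Qw → empty (short v Qv) (short w Qw))
            (≤-reflexive (sym (+-identityʳ B)))
    where
    empty : ∀ {σ τ : BitString} → length σ ≤ 0 → length τ ≤ 0 → σ ≡ τ
    empty {[]} {[]} _ _ = refl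
  pigeonhole (suc s) {N} c B Q h short fibre = begin
    count Q * c
      ≤⟨ *-monoˡ-≤ c (count-≤-3 Q Q₀ (Q₁ false) (Q₁ true) (λ v → split (Q v) (h v))) ⟩
    (count Q₀ + (count (Q₁ false) + count (Q₁ true))) * c
      ≡⟨ trans (*-distribʳ-+ c (count Q₀) _) (cong (count Q₀ * c +_) (*-distribʳ-+ c (count (Q₁ false)) _)) ⟩
    count Q₀ * c + (count (Q₁ false) * c + count (Q₁ true) * c)
      ≤⟨ +-mono-≤ Q₀-small (+-mono-≤ (Q₁-small false) (Q₁-small true)) ⟩
    B + (strings≤ s * B + strings≤ s * B)
      ≡⟨ cong (B +_) (*-distribʳ-+ B (strings≤ s) (strings≤ s)) ⟨
    strings≤ (suc s) * B ∎
    where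
    open ≤-Reasoning
    Q₀ : Vec Bool N → Bool
    Q₀ v = Q v ∧ null (h v)
    Q₁ : Bool → Vec Bool N → Bool
    Q₁ b v = Q v ∧ startsWith b (h v)
    split : ∀ q σ → 𝟙 q ≤ 𝟙 (q ∧ null σ) + (𝟙 (q ∧ startsWith false σ) + 𝟙 (q ∧ startsWith true σ))
    split false _           = z≤n
    split true  []          = s≤s z≤n
    split true  (false ∷ _) = s≤s z≤n
    split true  (true ∷ _)  = s≤s z≤n
    Q₀-small : count Q₀ * c ≤ B
    Q₀-small = fibre Q₀ (λ v → proj₁ ∘ ∧-true)
      λ v w p q → null-≡ (proj₂ (∧-true {Q v} p)) (proj₂ (∧-true {Q w} q))
    Q₁-small : ∀ b → count (Q₁ b) * c ≤ strings≤ s * B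
    Q₁-small b = pigeonhole s c B (Q₁ b) (tail ∘ h)
      (λ v p → length-tail (h v) (short v (proj₁ (∧-true p))))
      λ Q′ sub const → fibre Q′ (λ v → proj₁ ∘ ∧-true ∘ sub v)
        λ v w p q → startsWith-≡ b (proj₂ (∧-true {Q v} (sub v p))) (proj₂ (∧-true {Q w} (sub w q)))
          (const v w p q)

-- Derandomisation: coins that escape most of the covers.

module CoinSelection where

  open import Defs
  open Cube
  open import Data.Bool using (Bool; true; false)
  import Data.Integer as ℤ
  import Data.Integer.Properties as ℤ
  open import Data.Empty using (⊥)
  open import Data.List using ([]; _∷_; length)
  open import Data.Maybe using (Maybe; just; nothing)
  open import Data.Nat as ℕ using (ℕ; zero; suc; z≤n; s≤s)
  import Data.Nat.Properties as ℕ
  open import Data.Product using (∃; _×_; _,_; proj₁; proj₂)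
  open import Data.Sum using (_⊎_; inj₁; inj₂)
  open import Data.Rational hiding (truncate)
  open import Data.Rational.Properties
  import Data.Rational.Unnormalised as ℚᵘ
  import Data.Rational.Unnormalised.Properties as ℚᵘ
  open import Data.Rational.Solver using (module +-*-Solver)
  open import Data.Unit using (tt)
  open import Data.Vec using (Vec; []; _∷_)
  open import Function using (_∘_)
  open import Relation.Binary.PropositionalEquality
  open import Relation.Nullary using (yes; no)

  ι : ℕ → ℚ
  ι n = ℤ.+ n / 1

  toℚᵘ-ι : ∀ n → toℚᵘ (ι n) ℚᵘ.≃ ℚᵘ.mkℚᵘ (ℤ.+ n) 0
  toℚᵘ-ι n = toℚᵘ-fromℚᵘ (ℚᵘ.mkℚᵘ (ℤ.+ n) 0)

  ι-+ : ∀ m n → ι (m ℕ.+ n) ≡ ι m + ι n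
  ι-+ m n = toℚᵘ-injective (begin
    toℚᵘ (ι (m ℕ.+ n))                                   ≈⟨ toℚᵘ-ι (m ℕ.+ n) ⟩
    ℚᵘ.mkℚᵘ (ℤ.+ (m ℕ.+ n)) 0                            ≈⟨ ℚᵘ.*≡* (cong (ℤ._* ℤ.1ℤ) (cong₂ ℤ._+_ (sym (ℤ.*-identityʳ (ℤ.+ m))) (sym (ℤ.*-identityʳ (ℤ.+ n))))) ⟩
    ℚᵘ.mkℚᵘ (ℤ.+ m) 0 ℚᵘ.+ ℚᵘ.mkℚᵘ (ℤ.+ n) 0             ≈⟨ ℚᵘ.+-cong (ℚᵘ.≃-sym (toℚᵘ-ι m)) (ℚᵘ.≃-sym (toℚᵘ-ι n)) ⟩
    toℚᵘ (ι m) ℚᵘ.+ toℚᵘ (ι n)                           ≈⟨ ℚᵘ.≃-sym (toℚᵘ-homo-+ (ι m) (ι n)) ⟩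
    toℚᵘ (ι m + ι n)                                     ∎)
    where open ℚᵘ.≃-Reasoning

  ι-* : ∀ m n → ι (m ℕ.* n) ≡ ι m * ι n
  ι-* m n = toℚᵘ-injective (begin
    toℚᵘ (ι (m ℕ.* n))                                   ≈⟨ toℚᵘ-ι (m ℕ.* n) ⟩
    ℚᵘ.mkℚᵘ (ℤ.+ (m ℕ.* n)) 0                            ≈⟨ ℚᵘ.*≡* (cong (ℤ._* ℤ.1ℤ) (ℤ.pos-* m n)) ⟩
    ℚᵘ.mkℚᵘ (ℤ.+ m) 0 ℚᵘ.* ℚᵘ.mkℚᵘ (ℤ.+ n) 0             ≈⟨ ℚᵘ.*-cong (ℚᵘ.≃-sym (toℚᵘ-ι m)) (ℚᵘ.≃-sym (toℚᵘ-ι n)) ⟩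
    toℚᵘ (ι m) ℚᵘ.* toℚᵘ (ι n)                           ≈⟨ ℚᵘ.≃-sym (toℚᵘ-homo-* (ι m) (ι n)) ⟩
    toℚᵘ (ι m * ι n)                                     ∎)
    where open ℚᵘ.≃-Reasoning

  ι-mono-≤ : ∀ {m n} → m ℕ.≤ n → ι m ≤ ι n
  ι-mono-≤ {m} {n} m≤n = toℚᵘ-cancel-≤
    (ℚᵘ.≤-respʳ-≃ (ℚᵘ.≃-sym (toℚᵘ-ι n)) (ℚᵘ.≤-respˡ-≃ (ℚᵘ.≃-sym (toℚᵘ-ι m))
      (ℚᵘ.*≤* (ℤ.*-monoʳ-≤-nonNeg ℤ.1ℤ (ℤ.+≤+ m≤n)))))

  ι-cancel-≤ : ∀ {m n} → ι m ≤ ι n → m ℕ.≤ n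
  ι-cancel-≤ {m} {n} ιm≤ιn = ℤ.drop‿+≤+ (ℤ.*-cancelʳ-≤-pos (ℤ.+ m) (ℤ.+ n) ℤ.1ℤ
    (ℚᵘ.drop-*≤* (ℚᵘ.≤-respʳ-≃ (toℚᵘ-ι n) (ℚᵘ.≤-respˡ-≃ (toℚᵘ-ι m) (toℚᵘ-mono-≤ ιm≤ιn)))))

  ι-cancel-< : ∀ {m n} → ι m < ι n → m ℕ.< n
  ι-cancel-< {m} {n} ιm<ιn = ℕ.≰⇒> λ n≤m → <-irrefl refl (<-≤-trans ιm<ιn (ι-mono-≤ n≤m))

  +-medial : ∀ a b c d → (a + b) + (c + d) ≡ (a + c) + (b + d)
  +-medial = solve 4 (λ a b c d → (a :+ b) :+ (c :+ d) := (a :+ c) :+ (b :+ d)) refl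
    where open +-*-Solver

  ½-pos : ∀ {δ} → 0ℚ < δ → 0ℚ < ½ * δ
  ½-pos {δ} 0<δ = subst (_< ½ * δ) (*-zeroʳ ½) (*-monoʳ-<-pos ½ 0<δ)

  ½+½ : ∀ δ → ½ * δ + ½ * δ ≡ δ
  ½+½ δ = trans (sym (*-distribʳ-+ δ ½ ½)) (*-identityˡ δ)

  +-cancelʳ-≤ : ∀ c {a b} → a + c ≤ b + c → a ≤ b
  +-cancelʳ-≤ c {a} {b} p = subst₂ _≤_ (undo a c) (undo b c) (+-monoˡ-≤ (- c) p)
    where
    undo : ∀ a c → (a + c) + - c ≡ a
    undo = solve 2 (λ a c → (a :+ c) :+ :- c := a) refl
      where open +-*-Solver

  ∣p-q∣≤r⇒p≤q+r : ∀ p q {r} → ∣ p - q ∣ ≤ r → p ≤ q + r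
  ∣p-q∣≤r⇒p≤q+r p q {r} h = subst (_≤ q + r) (back q p) (+-monoʳ-≤ q (≤-trans (p≤∣p∣ (p - q)) h))
    where
    p≤∣p∣ : ∀ p → p ≤ ∣ p ∣
    p≤∣p∣ p with ≤-total 0ℚ p
    ... | inj₁ 0≤p = ≤-reflexive (sym (0≤p⇒∣p∣≡p 0≤p))
    ... | inj₂ p≤0 = ≤-trans p≤0 (0≤∣p∣ p)
    back : ∀ a b → a + (b - a) ≡ b
    back = solve 2 (λ a b → a :+ (b :- a) := b) refl
      where open +-*-Solver

  -- `nothing` marks a cylinder that the coins read so far have already missed; keeping it preserves
  -- the indices of the original cover.
  Words : Set
  Words = ℕ → Maybe BitString

  measure : Maybe BitString → ℚ
  measure nothing  = 0ℚ
  measure (just w) = cylinderMeasure w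

  mass : Words → ℕ → ℚ
  mass W zero    = 0ℚ
  mass W (suc k) = mass W k + measure (W k)

  -- What remains of a cylinder once the first coin is known; nothing if it is missed.
  residual : Bool → Maybe BitString → Maybe BitString
  residual b     nothing            = nothing
  residual b     (just [])          = just []
  residual true  (just (true ∷ w))  = just w
  residual true  (just (false ∷ w)) = nothing
  residual false (just (true ∷ w))  = nothing
  residual false (just (false ∷ w)) = just w

  cylinderMeasure-nonNeg : ∀ w → 0ℚ ≤ cylinderMeasure w
  cylinderMeasure-nonNeg []      = nonNegative⁻¹ 1ℚ
  cylinderMeasure-nonNeg (_ ∷ w) =
    subst (_≤ ½ * cylinderMeasure w) (*-zeroʳ ½) (*-monoˡ-≤-nonNeg ½ (cylinderMeasure-nonNeg w))

  measure-nonNeg : ∀ x → 0ℚ ≤ measure x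
  measure-nonNeg nothing  = ≤-refl
  measure-nonNeg (just w) = cylinderMeasure-nonNeg w

  -- The measure is the average of the two conditional measures given the first coin, doubled to
  -- avoid a division.
  measure-residual : ∀ x → measure (residual false x) + measure (residual true x) ≡ measure x + measure x
  measure-residual nothing            = refl
  measure-residual (just [])          = refl
  measure-residual (just (true ∷ w))  = trans (+-identityˡ (cylinderMeasure w)) (sym (½+½ (cylinderMeasure w)))
  measure-residual (just (false ∷ w)) = trans (+-identityʳ (cylinderMeasure w)) (sym (½+½ (cylinderMeasure w)))

  mass-residual : ∀ W k → mass (residual false ∘ W) k + mass (residual true ∘ W) k ≡ mass W k + mass W k
  mass-residual W zero    = refl
  mass-residual W (suc k) = begin
    (mass (residual false ∘ W) k + measure (residual false (W k))) + (mass (residual true ∘ W) k + measure (residual true (W k)))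
      ≡⟨ +-medial (mass (residual false ∘ W) k) _ _ _ ⟩
    (mass (residual false ∘ W) k + mass (residual true ∘ W) k) + (measure (residual false (W k)) + measure (residual true (W k)))
      ≡⟨ cong₂ _+_ (mass-residual W k) (measure-residual (W k)) ⟩
    (mass W k + mass W k) + (measure (W k) + measure (W k))
      ≡⟨ +-medial (mass W k) _ _ _ ⟩
    mass W (suc k) + mass W (suc k) ∎
    where open ≡-Reasoning

  mass-step : ∀ W k → mass W k ≤ mass W (suc k)
  mass-step W k = subst (_≤ mass W (suc k)) (+-identityʳ (mass W k)) (+-monoʳ-≤ (mass W k) (measure-nonNeg (W k)))

  mass-mono : ∀ W {m n} → m ℕ.≤ n → mass W m ≤ mass W n
  mass-mono W {m} m≤n = go (ℕ.≤⇒≤′ m≤n)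
    where
    go : ∀ {n} → m ℕ.≤′ n → mass W m ≤ mass W n
    go (ℕ.≤′-reflexive refl) = ≤-refl
    go (ℕ.≤′-step {n} p) = ≤-trans (go p) (mass-step W n)

  Family : ℕ → Set
  Family N = Vec Bool N → Words

  total : ∀ {N} → Family N → ℕ → ℚ
  total {N} F k = cubeSum _+_ N (λ v → mass (F v) k)

  total-mono : ∀ {N} (F : Family N) {m n} → m ℕ.≤ n → total F m ≤ total F n
  total-mono {N} F m≤n = cubeSum-rel _≤_ +-mono-≤ N (λ v → mass-mono (F v) m≤n)

  residuals : ∀ {N} → Bool → Family N → Family N
  residuals b F v = residual b ∘ F v

  total-residuals : ∀ {N} (F : Family N) k →
    total (residuals false F) k + total (residuals true F) k ≡ total F k + total F k
  total-residuals {N} F k = begin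
    total (residuals false F) k + total (residuals true F) k
      ≡⟨ cubeSum-distrib _+_ +-medial N _ _ ⟨
    cubeSum _+_ N (λ v → mass (residual false ∘ F v) k + mass (residual true ∘ F v) k)
      ≡⟨ cubeSum-rel _≡_ (cong₂ _+_) N (λ v → mass-residual (F v) k) ⟩
    cubeSum _+_ N (λ v → mass (F v) k + mass (F v) k)
      ≡⟨ cubeSum-distrib _+_ +-medial N _ _ ⟩
    total F k + total F k ∎
    where open ≡-Reasoning

  TailFrom : (ℕ → ℚ) → ℚ → ℕ → Set
  TailFrom x η K = ∀ k → K ℕ.≤ k → x k ≤ x K + η

  -- Since the totals increase, `tails` is a Cauchy modulus. It says where to cut off the series, so
  -- that a coin is chosen by comparing two rationals rather than two limits.
  record Cover {N} (F : Family N) (B : ℚ) : Set where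
    field
      tails : ∀ η → 0ℚ < η → ∃ (TailFrom (total F) η)
      bound : ∀ k → total F k ≤ B

  open Cover

  module _ {N} (F : Family N) {η K} (tailF : TailFrom (total F) (½ * η) K) where

    private
      bounded-pair : ∀ k → K ℕ.≤ k →
        total (residuals false F) k + total (residuals true F) k ≤
        (total (residuals false F) K + total (residuals true F) K) + η
      bounded-pair k K≤k = begin
        total (residuals false F) k + total (residuals true F) k ≡⟨ total-residuals F k ⟩
        total F k + total F k                                    ≤⟨ +-mono-≤ (tailF k K≤k) (tailF k K≤k) ⟩
        (total F K + ½ * η) + (total F K + ½ * η)                ≡⟨ +-medial (total F K) _ _ _ ⟩
        (total F K + total F K) + (½ * η + ½ * η)                ≡⟨ cong₂ _+_ (sym (total-residuals F K)) (½+½ η) ⟩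
        (total (residuals false F) K + total (residuals true F) K) + η ∎
        where open ≤-Reasoning

      swap : ∀ a b c → (a + b) + c ≡ (a + c) + b
      swap = solve 3 (λ a b c → (a :+ b) :+ c := (a :+ c) :+ b) refl
        where open +-*-Solver

      swap′ : ∀ a b c → (a + b) + c ≡ (b + c) + a
      swap′ = solve 3 (λ a b c → (a :+ b) :+ c := (b :+ c) :+ a) refl
        where open +-*-Solver

    -- Beyond `K` the increments of the two residual totals add up to twice the increment of
    -- `total F`, hence to at most η. Both are nonnegative, so each is at most η.
    tail-residuals : ∀ b → TailFrom (total (residuals b F)) η K
    tail-residuals false k K≤k = +-cancelʳ-≤ (total (residuals true F) k)
      (≤-trans (bounded-pair k K≤k)
      (≤-trans (≤-reflexive (swap (total (residuals false F) K) _ η))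
      (+-monoʳ-≤ (total (residuals false F) K + η) (total-mono (residuals true F) K≤k))))
    tail-residuals true k K≤k = +-cancelʳ-≤ (total (residuals false F) k)
      (≤-trans (≤-reflexive (+-comm _ (total (residuals false F) k)))
      (≤-trans (bounded-pair k K≤k)
      (≤-trans (≤-reflexive (swap′ (total (residuals false F) K) _ η))
      (+-monoʳ-≤ (total (residuals true F) K + η) (total-mono (residuals false F) K≤k)))))

  smaller : ∀ {a b c} → a + b ≡ c + c → a ≤ c ⊎ b ≤ c
  smaller {a} {b} {c} eq with a ≤? c
  ... | yes a≤c = inj₁ a≤c
  ... | no  a≰c = inj₂ (+-cancelʳ-≤ c (≤-trans (+-monoʳ-≤ b (<⇒≤ (≰⇒> a≰c))) (≤-reflexive (trans (+-comm b a) eq))))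

  -- The next coin is the one whose residual family has the smaller truncated
  -- mass; truncating costs η.
  next : ∀ {N} {F : Family N} {B} → Cover F B → ∀ η → 0ℚ < η →
    ∃ λ b → Cover (residuals b F) (B + η)
  next {N} {F} {B} C η 0<η = choose (smaller {total (residuals false F) K} (total-residuals F K))
    where
    tail½ = tails C (½ * η) (½-pos 0<η)
    K = proj₁ tail½

    residual-cover : ∀ b → total (residuals b F) K ≤ total F K → Cover (residuals b F) (B + η)
    residual-cover b light = record
      { tails = λ ζ 0<ζ → let K′ , t = tails C (½ * ζ) (½-pos 0<ζ) in K′ , tail-residuals F t b
      ; bound = λ k → ≤-trans (below k (ℕ.≤-total k K)) (+-monoˡ-≤ η (≤-trans light (bound C K)))
      }
      where
      below : ∀ k → k ℕ.≤ K ⊎ K ℕ.≤ k → total (residuals b F) k ≤ total (residuals b F) K + η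
      below k (inj₁ k≤K) = ≤-trans (total-mono (residuals b F) k≤K)
        (subst (_≤ total (residuals b F) K + η) (+-identityʳ _) (+-monoʳ-≤ (total (residuals b F) K) (<⇒≤ 0<η)))
      below k (inj₂ K≤k) = tail-residuals F (proj₂ tail½) b k K≤k

    choose : total (residuals false F) K ≤ total F K ⊎ total (residuals true F) K ≤ total F K →
      ∃ λ b → Cover (residuals b F) (B + η)
    choose (inj₁ p) = false , residual-cover false p
    choose (inj₂ p) = true  , residual-cover true  p

  -- The truncation errors η/2, η/4, ... never exceed η in total: each step moves half of the
  -- remaining budget into the bound, so B + η is invariant.
  coins : ∀ {N} {F : Family N} {B} → Cover F B → ∀ η → 0ℚ < η → Coins
  coins C η 0<η zero    = proj₁ (next C (½ * η) (½-pos 0<η))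
  coins C η 0<η (suc i) = coins (proj₂ (next C (½ * η) (½-pos 0<η))) (½ * η) (½-pos 0<η) i

  cube-max : ∀ {N} (f : Vec Bool N → ℕ) → ∃ λ M → ∀ v → f v ℕ.≤ M
  cube-max {zero}  f = f [] , λ { [] → ℕ.≤-refl }
  cube-max {suc N} f =
    let M₀ , p₀ = cube-max (f ∘ (false ∷_))
        M₁ , p₁ = cube-max (f ∘ (true ∷_))
    in M₀ ℕ.⊔ M₁ , λ { (false ∷ v) → ℕ.≤-trans (p₀ v) (ℕ.m≤m⊔n M₀ M₁)
                     ; (true ∷ v)  → ℕ.≤-trans (p₁ v) (ℕ.m≤n⊔m M₀ M₁) }

  marked : Maybe ℕ → ℕ
  marked nothing  = 0
  marked (just _) = 1

  Hit : Coins → ℕ → Maybe BitString → Set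
  Hit ω L nothing  = ⊥
  Hit ω L (just w) = w isPrefixOf ω × length w ℕ.≤ L

  Hit-residual : ∀ {ω L} x → Hit ω (suc L) x → Hit (ω ∘ suc) L (residual (ω 0) x)
  Hit-residual nothing ()
  Hit-residual (just []) (p , q) = tt , z≤n
  Hit-residual {ω} (just (c ∷ w)) ((c≡ , p) , s≤s q) with ω 0 | c≡
  Hit-residual {ω} (just (true ∷ w))  ((c≡ , p) , s≤s q) | _ | refl = p , q
  Hit-residual {ω} (just (false ∷ w)) ((c≡ , p) , s≤s q) | _ | refl = p , q

  -- `κ` names, for some of the vectors, a cylinder that contains the coins. Once `L` coins are
  -- read, each named cylinder of length at most `L` has the residual `just []` of measure 1, so the
  -- number of such vectors is at most the remaining total mass.
  hits-bounded : ∀ L {N} {F : Family N} {B} (C : Cover F B) η (0<η : 0ℚ < η) (κ : Vec Bool N → Maybe ℕ) →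
    (∀ v k → κ v ≡ just k → Hit (coins C η 0<η) L (F v k)) →
    cubeSum _+_ N (ι ∘ marked ∘ κ) ≤ B + η
  hits-bounded (suc L) {B = B} C η 0<η κ hits =
    ≤-trans (hits-bounded L (proj₂ (next C (½ * η) (½-pos 0<η))) (½ * η) (½-pos 0<η) κ
              (λ v k eq → Hit-residual {coins C η 0<η} _ (hits v k eq)))
            (≤-reflexive (trans (+-assoc B _ _) (cong (B +_) (½+½ η))))
  hits-bounded zero {N} {F} {B} C η 0<η κ hits = begin
    cubeSum _+_ N (ι ∘ marked ∘ κ)  ≤⟨ cubeSum-rel _≤_ +-mono-≤ N (λ v → hit v (κ v) refl) ⟩
    total F K                       ≤⟨ bound C K ⟩
    B                               ≡⟨ +-identityʳ B ⟨
    B + 0ℚ                          ≤⟨ +-monoʳ-≤ B (<⇒≤ 0<η) ⟩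
    B + η                           ∎
    where
    open ≤-Reasoning
    index : Maybe ℕ → ℕ
    index nothing  = 0
    -- `mass W k` sums the words before `k`, so word `k` itself counts only from `suc k` on.
    index (just k) = suc k
    K = proj₁ (cube-max (index ∘ κ))
    mass-nonNeg : ∀ W k → 0ℚ ≤ mass W k
    mass-nonNeg W k = mass-mono W {0} {k} z≤n
    unit : ∀ x → Hit (coins C η 0<η) 0 x → 1ℚ ≤ measure x
    unit (just []) _ = ≤-refl
    unit nothing ()
    hit : ∀ v x → κ v ≡ x → ι (marked x) ≤ mass (F v) K
    hit v nothing  eq = mass-nonNeg (F v) K
    hit v (just k) eq = begin
      1ℚ                                    ≤⟨ unit (F v k) (hits v k eq) ⟩
      measure (F v k)                       ≡⟨ +-identityˡ _ ⟨
      0ℚ + measure (F v k)                  ≤⟨ +-monoˡ-≤ (measure (F v k)) (mass-nonNeg (F v) k) ⟩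
      mass (F v) (suc k)                    ≤⟨ mass-mono (F v) (subst (ℕ._≤ K) (cong index eq) (proj₂ (cube-max (index ∘ κ)) v)) ⟩
      mass (F v) K                          ∎

  cauchy-cubeSum : ∀ M (x : Vec Bool M → ℕ → ℚ) → (∀ v → IsCauchy (x v)) →
    ∀ η → 0ℚ < η → ∃ λ K → ∀ m k → K ℕ.≤ m → K ℕ.≤ k →
      cubeSum _+_ M (λ v → x v m) ≤ cubeSum _+_ M (λ v → x v k) + η
  cauchy-cubeSum zero x cx η 0<η =
    let K , p = cx [] η 0<η in K , λ m k l r → ∣p-q∣≤r⇒p≤q+r (x [] m) (x [] k) (p m k l r)
  cauchy-cubeSum (suc M) x cx η 0<η =
    let K₀ , p₀ = cauchy-cubeSum M (x ∘ (false ∷_)) (cx ∘ (false ∷_)) (½ * η) (½-pos 0<η)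
        K₁ , p₁ = cauchy-cubeSum M (x ∘ (true ∷_)) (cx ∘ (true ∷_)) (½ * η) (½-pos 0<η)
    in K₀ ℕ.⊔ K₁ , λ m k l r → ≤-trans
      (+-mono-≤ (p₀ m k (ℕ.m⊔n≤o⇒m≤o K₀ K₁ l) (ℕ.m⊔n≤o⇒m≤o K₀ K₁ r))
                (p₁ m k (ℕ.m⊔n≤o⇒n≤o K₀ K₁ l) (ℕ.m⊔n≤o⇒n≤o K₀ K₁ r)))
      (≤-reflexive (trans (+-medial (cubeSum _+_ M (λ v → x (false ∷ v) k)) _ _ _)
                           (cong (cubeSum _+_ (suc M) (λ v → x v k) +_) (½+½ η))))

  module _ {N} (U : Vec Bool N → ℕ → BitString) (cauchy-U : ∀ v → IsCauchy (partialSum (U v)))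
           (β : ℚ) (U≤β : ∀ v k → partialSum (U v) k ≤ β) where

    private
      F : Family N
      F v = just ∘ U v

      mass≡partialSum : ∀ u k → mass (just ∘ u) k ≡ partialSum u k
      mass≡partialSum u zero    = refl
      mass≡partialSum u (suc k) = cong (_+ cylinderMeasure (u k)) (mass≡partialSum u k)

    private
      total≡ : ∀ k → total F k ≡ cubeSum _+_ N (λ v → partialSum (U v) k)
      total≡ k = cubeSum-rel _≡_ (cong₂ _+_) N (λ v → mass≡partialSum (U v) k)

      cover : Cover F (cubeSum _+_ N (λ _ → β))
      cover = record
        { tails = λ η 0<η → let K , p = cauchy-cubeSum N (partialSum ∘ U) cauchy-U η 0<η in
            K , λ k K≤k → subst₂ (λ a b → a ≤ b + η) (sym (total≡ k)) (sym (total≡ K)) (p k K K≤k ℕ.≤-refl)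
        ; bound = λ k → ≤-trans (≤-reflexive (total≡ k)) (cubeSum-rel _≤_ +-mono-≤ N (λ v → U≤β v k))
        }

    -- ω is fixed before `κ`: the coins cannot depend on which cylinders turn out to be hit, as this
    -- is known only under a double negation. The length cap `L` does depend on `κ`, but occurs only
    -- in the proof of the bound.
    avoiding-coins : ∀ η → 0ℚ < η → ∃ λ ω → (κ : Vec Bool N → Maybe ℕ) →
      (∀ v k → κ v ≡ just k → U v k isPrefixOf ω) →
      cubeSum _+_ N (ι ∘ marked ∘ κ) ≤ cubeSum _+_ N (λ _ → β) + η
    avoiding-coins η 0<η = coins cover η 0<η , λ κ hits →
      let len : Vec Bool N → ℕ
          len v = wordLength v (κ v)
          L , len≤L = cube-max len
      in hits-bounded L cover η 0<η κ λ v k eq →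
           hits v k eq , subst (ℕ._≤ L) (cong (wordLength v) eq) (len≤L v)
      where
      wordLength : Vec Bool N → Maybe ℕ → ℕ
      wordLength v nothing  = 0
      wordLength v (just k) = length (U v k)

-- From likely success to a counting bound on sketches.

module SketchCount where

  open import Defs
  open Cube
  open CoinSelection
  open import Data.Bool using (Bool; true; false; not)
  import Data.Integer as ℤ
  open import Data.List using (length)
  open import Data.Maybe using (Maybe; just; nothing)
  open import Data.Nat as ℕ using (ℕ; zero; suc; _^_)
  import Data.Nat.Properties as ℕ
  open import Data.Nat.Tactic.RingSolver using (solve-∀)
  open import Data.Product using (∃; _×_; _,_; proj₁; proj₂)
  open import Data.Rational hiding (truncate)
  open import Data.Rational.Properties
  open import Data.Vec using (Vec; []; _∷_)
  open import Function using (_∘_)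
  open import Relation.Binary.PropositionalEquality
  open import Relation.Nullary using (¬_; Dec; yes; no)
  open import Relation.Nullary.Decidable using (does; decidable-stable; ¬¬-excluded-middle)

  -- Being hit by a cover is an unbounded search and so undecidable, but excluded middle for
  -- finitely many propositions at once is still irrefutable.
  ¬¬-decide : ∀ {N} (P : Vec Bool N → Set) → ¬ ¬ (∀ v → Dec (P v))
  ¬¬-decide {zero}  P k = ¬¬-excluded-middle λ d → k λ { [] → d }
  ¬¬-decide {suc N} P k =
    ¬¬-decide (P ∘ (false ∷_)) λ d₀ → ¬¬-decide (P ∘ (true ∷_)) λ d₁ →
      k λ { (false ∷ v) → d₀ v ; (true ∷ v) → d₁ v }

  module _ {N} (A : Vec Bool N → Coins → Set) (likely : ∀ v → Probability≥ (ℤ.+ 3 / 4) (A v)) where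

    private
      0<1/16 : 0ℚ < ℤ.+ 1 / 16
      0<1/16 = positive⁻¹ (ℤ.+ 1 / 16)

      U : Vec Bool N → ℕ → BitString
      U v = proj₁ (likely v (ℤ.+ 1 / 16) 0<1/16)

      -- Each cover has mass at most 1 - 3/4 + 1/16 = 5/16. The second 1/16 is the budget for
      -- choosing the coins; as the cube has at least one vertex, both together stay within 3/8 of
      -- the cube.
      avoiding : ∃ λ ω → (κ : Vec Bool N → Maybe ℕ) →
        (∀ v k → κ v ≡ just k → U v k isPrefixOf ω) →
        cubeSum _+_ N (ι ∘ marked ∘ κ) ≤ cubeSum _+_ N (λ _ → ℤ.+ 5 / 16) + ℤ.+ 1 / 16
      avoiding = avoiding-coins U
        (λ v → proj₁ (proj₂ (likely v (ℤ.+ 1 / 16) 0<1/16))) _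
        (λ v → proj₁ (proj₂ (proj₂ (likely v (ℤ.+ 1 / 16) 0<1/16)))) (ℤ.+ 1 / 16) 0<1/16

      slack : ∀ M → cubeSum _+_ M (λ _ → ℤ.+ 5 / 16) + ℤ.+ 1 / 16 ≤ cubeSum _+_ M (λ _ → ℤ.+ 3 / 8)
      slack zero    = ≤-refl
      slack (suc M) = begin
        (S + S) + ℤ.+ 1 / 16 ≡⟨ +-assoc S S (ℤ.+ 1 / 16) ⟩
        S + (S + ℤ.+ 1 / 16) ≡⟨ cong (_+ (S + ℤ.+ 1 / 16)) (+-identityʳ S) ⟨
        (S + 0ℚ) + (S + ℤ.+ 1 / 16) ≤⟨ +-mono-≤ (≤-trans (+-monoʳ-≤ S (<⇒≤ 0<1/16)) (slack M)) (slack M) ⟩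
        cubeSum _+_ (suc M) (λ _ → ℤ.+ 3 / 8) ∎
        where
        open ≤-Reasoning
        S = cubeSum _+_ M (λ _ → ℤ.+ 5 / 16)

      ι-cubeSum : ∀ (f : Vec Bool N → ℕ) → ι (cubeSum ℕ._+_ N f) ≡ cubeSum _+_ N (ι ∘ f)
      ι-cubeSum f = cubeSum-rel (λ x y → ι x ≡ y) (λ {a} {b} {c} {d} p q → trans (ι-+ a c) (cong₂ _+_ p q)) N (λ _ → refl)

      8*⅜ : ι 8 * cubeSum _+_ N (λ _ → ℤ.+ 3 / 8) ≡ ι (2 ^ N ℕ.* 3)
      8*⅜ = trans (cubeSum-rel (λ x y → ι 8 * x ≡ y) (λ {a} {b} {c} {d} p q → trans (*-distribˡ-+ (ι 8) a c) (cong₂ _+_ p q)) N (λ _ → refl))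
                  (trans (sym (ι-cubeSum (λ _ → 3))) (cong ι (cubeSum-const N 3)))

    ω₀ : Coins
    ω₀ = proj₁ avoiding

    ¬¬-mostly : ¬ ¬ (∃ λ (good : Vec Bool N → Bool) →
      (∀ v → good v ≡ true → A v ω₀) × 5 ℕ.* 2 ^ N ℕ.≤ 8 ℕ.* count good)
    ¬¬-mostly ¬mostly = ¬¬-decide (λ v → ∃ λ k → U v k isPrefixOf ω₀) λ hit? →
      let bad : Vec Bool N → Bool
          bad v = does (hit? v)

          few : 8 ℕ.* count bad ℕ.≤ 2 ^ N ℕ.* 3
          few = ι-cancel-≤ (begin
            ι (8 ℕ.* count bad)                        ≡⟨ ι-* 8 (count bad) ⟩
            ι 8 * ι (count bad)
              ≡⟨ cong (ι 8 *_) (trans (ι-cubeSum (𝟙 ∘ bad)) (cubeSum-rel _≡_ (cong₂ _+_) N (λ v → cong ι (𝟙≡marked (hit? v))))) ⟩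
            ι 8 * cubeSum _+_ N (ι ∘ marked ∘ index ∘ hit?)
              ≤⟨ *-monoˡ-≤-nonNeg (ι 8) (≤-trans (proj₂ avoiding (index ∘ hit?) (λ v k → index-hits (hit? v))) (slack N)) ⟩
            ι 8 * cubeSum _+_ N (λ _ → ℤ.+ 3 / 8)      ≡⟨ 8*⅜ ⟩
            ι (2 ^ N ℕ.* 3)                            ∎)
      in ¬mostly (not ∘ bad ,
                  (λ v → proj₂ (proj₂ (proj₂ (likely v (ℤ.+ 1 / 16) 0<1/16))) ω₀ ∘ unhit (hit? v)) ,
                  many (count bad) (count-not bad) few)
      where
      open ≤-Reasoning
      index : ∀ {P : ℕ → Set} → Dec (∃ P) → Maybe ℕ
      index (yes (k , _)) = just k
      index (no _)        = nothing
      index-hits : ∀ {P : ℕ → Set} (d : Dec (∃ P)) {k} → index d ≡ just k → P k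
      index-hits (yes (_ , p)) refl = p
      𝟙≡marked : ∀ {P : ℕ → Set} (d : Dec (∃ P)) → 𝟙 (does d) ≡ marked (index d)
      𝟙≡marked (yes _) = refl
      𝟙≡marked (no _)  = refl
      unhit : ∀ {P : ℕ → Set} (d : Dec (∃ P)) → not (does d) ≡ true → ∀ i → ¬ P i
      unhit (no ¬p) _ i p = ¬p (i , p)
      many : ∀ b {g M} → b ℕ.+ g ≡ M → 8 ℕ.* b ℕ.≤ M ℕ.* 3 → 5 ℕ.* M ℕ.≤ 8 ℕ.* g
      many b {g} refl few = ℕ.+-cancelˡ-≤ (8 ℕ.* b) _ _
        (ℕ.≤-trans (ℕ.+-monoˡ-≤ (5 ℕ.* (b ℕ.+ g)) few) (ℕ.≤-reflexive (regroup b g)))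
        where
        regroup : ∀ b g → (b ℕ.+ g) ℕ.* 3 ℕ.+ 5 ℕ.* (b ℕ.+ g) ≡ 8 ℕ.* b ℕ.+ 8 ℕ.* g
        regroup = solve-∀

    -- At the coins `ω₀` the map `h ω₀` is a deterministic encoding of the good vectors, at least
    -- 5/8 of the cube, and its fibres there have diameter at most `r`. The conclusion is decidable,
    -- which removes the double negation from `¬¬-mostly`.
    sketch-bound : ∀ (h : Coins → Vec Bool N → BitString) s → (∀ ω v → length (h ω v) ℕ.≤ s) →
      ∀ ℓ r → 0 ℕ.< ℓ →
      (∀ ω v w → A v ω → A w ω → h ω v ≡ h ω w → hamming v w ℕ.≤ r) →
      5 ℕ.* 2 ^ N ℕ.* ℓ ^ N ℕ.≤ 8 ℕ.* (strings≤ s ℕ.* (suc ℓ ^ N ℕ.* ℓ ^ r))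
    sketch-bound h s short ℓ@(suc _) r 0<ℓ close = decidable-stable (_ ℕ.≤? _) λ ¬bound →
      ¬¬-mostly λ { (good , works , many) → ¬bound (begin
        5 ℕ.* 2 ^ N ℕ.* ℓ ^ N        ≤⟨ ℕ.*-monoˡ-≤ (ℓ ^ N) many ⟩
        8 ℕ.* count good ℕ.* ℓ ^ N   ≡⟨ ℕ.*-assoc 8 (count good) (ℓ ^ N) ⟩
        8 ℕ.* (count good ℕ.* ℓ ^ N) ≤⟨ ℕ.*-monoʳ-≤ 8 (scaled good works) ⟩
        8 ℕ.* (strings≤ s ℕ.* (suc ℓ ^ N ℕ.* ℓ ^ r)) ∎) }
      where
      open ℕ.≤-Reasoning
      scaled : ∀ good → (∀ v → good v ≡ true → A v ω₀) →
        count good ℕ.* ℓ ^ N ℕ.≤ strings≤ s ℕ.* (suc ℓ ^ N ℕ.* ℓ ^ r)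
      scaled good works = pigeonhole s (ℓ ^ N) (suc ℓ ^ N ℕ.* ℓ ^ r) good (h ω₀) (λ v _ → short ω₀ v)
        λ Q sub const → count-close ℓ r 0<ℓ Q λ v w Qv Qw →
          close ω₀ v w (works v (sub v Qv)) (works w (sub w Qw)) (const v w Qv Qw)

-- Cuts of bipartite graphs as sums over matrix entries.

module Cuts where

  open import Defs using (Graph; adj; symm; irrefl; cutSize)
  open Cube
  open import Data.Bool using (Bool; true; false; not; _∧_; _xor_)
  import Data.Bool.Properties as Bool
  open import Data.Fin using (Fin; zero; suc; _↑ˡ_; _↑ʳ_; splitAt)
  import Data.Fin.Properties as Fin
  open import Data.Fin.Subset using (Subset; ∁)
  open import Data.Fin.Subset.Properties using (_∈?_)
  open import Data.Integer hiding (suc; sign)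
  open import Data.Integer.Properties
  open import Data.List using (_∷_; length; filter; cartesianProduct; map)
  import Data.List as List
  open import Data.List.Properties using (length-++; filter-++; map-tabulate)
  open import Data.Nat as ℕ using (ℕ; zero; suc)
  open import Data.Product using (_×_; _,_)
  open import Data.Sum using (_⊎_; inj₁; inj₂)
  open import Data.Vec as Vec using (_∷_; lookup; tabulate)
  import Data.Vec.Properties as Vec
  open import Function using (_∘_; id)
  open import Relation.Binary.PropositionalEquality
  open import Relation.Nullary using (does)
  open import Relation.Nullary.Decidable using (_×-dec_)
  open import Relation.Unary using (Decidable)
  open import Algebra.Properties.Semiring.Sum +-*-semiring public
    using (sum; ∑-distrib-+; ∑-comm; sum-cong-≗; *-distribˡ-sum; sum-replicate-zero)

  ⟦_⟧ : Bool → ℤ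
  ⟦ b ⟧ = + 𝟙 b

  module _ {A : Set} {P : A → Set} (P? : Decidable P) where

    length-filter-∷ : ∀ x xs → + length (filter P? (x ∷ xs)) ≡ ⟦ does (P? x) ⟧ + + length (filter P? xs)
    length-filter-∷ x xs with does (P? x)
    ... | true  = refl
    ... | false = sym (+-identityˡ _)

    length-filter-tabulate : ∀ {n} (f : Fin n → A) →
      + length (filter P? (List.tabulate f)) ≡ sum (λ i → ⟦ does (P? (f i)) ⟧)
    length-filter-tabulate {zero}  f = refl
    length-filter-tabulate {suc n} f =
      trans (length-filter-∷ (f zero) _) (cong (_+_ ⟦ does (P? (f zero)) ⟧) (length-filter-tabulate (f ∘ suc)))

  length-filter-product : ∀ {A B : Set} {P : A × B → Set} (P? : Decidable P) {m n} (f : Fin m → A) (g : Fin n → B) →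
    + length (filter P? (cartesianProduct (List.tabulate f) (List.tabulate g))) ≡
    sum (λ i → sum (λ j → ⟦ does (P? (f i , g j)) ⟧))
  length-filter-product P? {zero}  f g = refl
  length-filter-product P? {suc m} f g = begin
    + length (filter P? (row List.++ rest))                ≡⟨ cong (+_ ∘ length) (filter-++ P? row rest) ⟩
    + length (filter P? row List.++ filter P? rest)        ≡⟨ cong +_ (length-++ (filter P? row)) ⟩
    + length (filter P? row) + + length (filter P? rest)
      ≡⟨ cong₂ _+_ (trans (cong (+_ ∘ length ∘ filter P?) (map-tabulate g (f zero ,_)))
                          (length-filter-tabulate P? (λ j → f zero , g j)))
                   (length-filter-product P? (f ∘ suc) g) ⟩
    sum (λ i → sum (λ j → ⟦ does (P? (f i , g j)) ⟧)) ∎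
    where
    open ≡-Reasoning
    row  = map (f zero ,_) (List.tabulate g)
    rest = cartesianProduct (List.tabulate (f ∘ suc)) (List.tabulate g)

  does-∈? : ∀ {n} (u : Fin n) (S : Subset n) → does (u ∈? S) ≡ lookup S u
  does-∈? zero    (true ∷ S)  = refl
  does-∈? zero    (false ∷ S) = refl
  does-∈? (suc u) (_ ∷ S)     = does-∈? u S

  does-≟-true : ∀ b → does (b Bool.≟ true) ≡ b
  does-≟-true true  = refl
  does-≟-true false = refl

  cutSize-sum : ∀ {n} (G : Graph n) (S : Subset n) →
    + cutSize G S ≡ sum (λ u → sum (λ v → ⟦ lookup S u ∧ (not (lookup S v) ∧ adj G u v) ⟧))
  cutSize-sum {n} G S = trans
    (length-filter-product (λ (u , v) → (u ∈? S) ×-dec (v ∈? ∁ S) ×-dec (adj G u v Bool.≟ true)) id id)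
    (sum-cong-≗ λ u → sum-cong-≗ λ v → cong ⟦_⟧ (cong₂ _∧_ (does-∈? u S)
      (cong₂ _∧_ (trans (does-∈? v (∁ S)) (Vec.lookup-map v not S)) (does-≟-true (adj G u v)))))

  sum-splitAt : ∀ d {p} (f : Fin (d ℕ.+ p) → ℤ) → sum f ≡ sum (λ i → f (i ↑ˡ p)) + sum (λ j → f (d ↑ʳ j))
  sum-splitAt zero    f = sym (+-identityˡ _)
  sum-splitAt (suc d) f = trans (cong (_+_ (f zero)) (sum-splitAt d (f ∘ suc))) (sym (+-assoc (f zero) _ _))

  Matrix : ℕ → ℕ → Set
  Matrix d p = Fin d → Fin p → Bool

  module _ {d p : ℕ} (A : Matrix d p) where

    private
      edge : Fin d ⊎ Fin p → Fin d ⊎ Fin p → Bool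
      edge (inj₁ i) (inj₂ j) = A i j
      edge (inj₂ j) (inj₁ i) = A i j
      edge _        _        = false

      edge-sym : ∀ u v → edge u v ≡ edge v u
      edge-sym (inj₁ _) (inj₁ _) = refl
      edge-sym (inj₁ _) (inj₂ _) = refl
      edge-sym (inj₂ _) (inj₁ _) = refl
      edge-sym (inj₂ _) (inj₂ _) = refl

      edge-irrefl : ∀ u → edge u u ≡ false
      edge-irrefl (inj₁ _) = refl
      edge-irrefl (inj₂ _) = refl

    bipartite : Graph (d ℕ.+ p)
    bipartite = record
      { adj    = λ u v → edge (splitAt d u) (splitAt d v)
      ; symm   = λ u v → edge-sym (splitAt d u) (splitAt d v)
      ; irrefl = λ v → edge-irrefl (splitAt d v)
      }

    cut : (Fin d → Bool) → (Fin p → Bool) → ℤ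
    cut x y = sum λ i → sum λ j → ⟦ (x i xor y j) ∧ A i j ⟧

    -- `∂` orients an edge from its end in `S`. Only pairs from opposite parts carry edges, and the
    -- two orientations of such a pair are the two disjoint ways for `x i xor y j` to hold.
    cutSize-bipartite : ∀ x y → + cutSize bipartite (tabulate x Vec.++ tabulate y) ≡ cut x y
    cutSize-bipartite x y = begin
      + cutSize bipartite S
        ≡⟨ cutSize-sum bipartite S ⟩
      sum (λ u → sum (λ v → ⟦ term u v ⟧))
        ≡⟨ sum-splitAt d _ ⟩
      sum (λ i → sum (λ v → ⟦ term (i ↑ˡ p) v ⟧)) + sum (λ j → sum (λ v → ⟦ term (d ↑ʳ j) v ⟧))
        ≡⟨ cong₂ _+_ (sum-cong-≗ left) (trans (sum-cong-≗ right) (∑-comm λ j i → ⟦ y j ∧ (not (x i) ∧ A i j) ⟧)) ⟩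
      sum (λ i → sum (λ j → ⟦ x i ∧ (not (y j) ∧ A i j) ⟧)) + sum (λ i → sum (λ j → ⟦ y j ∧ (not (x i) ∧ A i j) ⟧))
        ≡⟨ ∑-distrib-+ {d} (λ i → sum (λ j → ⟦ x i ∧ (not (y j) ∧ A i j) ⟧)) (λ i → sum (λ j → ⟦ y j ∧ (not (x i) ∧ A i j) ⟧)) ⟨
      sum (λ i → sum (λ j → ⟦ x i ∧ (not (y j) ∧ A i j) ⟧) + sum (λ j → ⟦ y j ∧ (not (x i) ∧ A i j) ⟧))
        ≡⟨ sum-cong-≗ (λ i → trans (sym (∑-distrib-+ (λ j → ⟦ x i ∧ (not (y j) ∧ A i j) ⟧) (λ j → ⟦ y j ∧ (not (x i) ∧ A i j) ⟧)))
             (sum-cong-≗ λ j → xor-split (x i) (y j) (A i j))) ⟩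
      cut x y ∎
      where
      open ≡-Reasoning
      S = tabulate x Vec.++ tabulate y
      term : Fin (d ℕ.+ p) → Fin (d ℕ.+ p) → Bool
      term u v = lookup S u ∧ (not (lookup S v) ∧ adj bipartite u v)

      lookupˡ : ∀ i → lookup S (i ↑ˡ p) ≡ x i
      lookupˡ i = trans (Vec.lookup-++ˡ (tabulate x) (tabulate y) i) (Vec.lookup∘tabulate x i)
      lookupʳ : ∀ j → lookup S (d ↑ʳ j) ≡ y j
      lookupʳ j = trans (Vec.lookup-++ʳ (tabulate x) (tabulate y) j) (Vec.lookup∘tabulate y j)

      no-edge : ∀ a b → ⟦ a ∧ (b ∧ false) ⟧ ≡ 0ℤ
      no-edge false b = refl
      no-edge true  b = cong ⟦_⟧ (Bool.∧-zeroʳ b)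

      left : ∀ i → sum (λ v → ⟦ term (i ↑ˡ p) v ⟧) ≡ sum (λ j → ⟦ x i ∧ (not (y j) ∧ A i j) ⟧)
      left i = trans (sum-splitAt d _) (trans (cong₂ _+_
        (trans (sum-cong-≗ λ i′ → trans
          (cong₂ (λ s t → ⟦ lookup S (i ↑ˡ p) ∧ (not (lookup S (i′ ↑ˡ p)) ∧ edge s t) ⟧) (Fin.splitAt-↑ˡ d i p) (Fin.splitAt-↑ˡ d i′ p))
          (no-edge (lookup S (i ↑ˡ p)) _)) (sum-replicate-zero d))
        (sum-cong-≗ λ j → trans
          (cong₂ (λ s t → ⟦ lookup S (i ↑ˡ p) ∧ (not (lookup S (d ↑ʳ j)) ∧ edge s t) ⟧) (Fin.splitAt-↑ˡ d i p) (Fin.splitAt-↑ʳ d p j))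
          (cong₂ (λ a b → ⟦ a ∧ (not b ∧ A i j) ⟧) (lookupˡ i) (lookupʳ j))))
        (+-identityˡ _))

      right : ∀ j → sum (λ v → ⟦ term (d ↑ʳ j) v ⟧) ≡ sum (λ i → ⟦ y j ∧ (not (x i) ∧ A i j) ⟧)
      right j = trans (sum-splitAt d _) (trans (cong₂ _+_
        (sum-cong-≗ λ i → trans
          (cong₂ (λ s t → ⟦ lookup S (d ↑ʳ j) ∧ (not (lookup S (i ↑ˡ p)) ∧ edge s t) ⟧) (Fin.splitAt-↑ʳ d p j) (Fin.splitAt-↑ˡ d i p))
          (cong₂ (λ a b → ⟦ a ∧ (not b ∧ A i j) ⟧) (lookupʳ j) (lookupˡ i)))
        (trans (sum-cong-≗ λ j′ → trans
          (cong₂ (λ s t → ⟦ lookup S (d ↑ʳ j) ∧ (not (lookup S (d ↑ʳ j′)) ∧ edge s t) ⟧) (Fin.splitAt-↑ʳ d p j) (Fin.splitAt-↑ʳ d p j′))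
          (no-edge (lookup S (d ↑ʳ j)) _)) (sum-replicate-zero p)))
        (+-identityʳ _))

      xor-split : ∀ x y a → ⟦ x ∧ (not y ∧ a) ⟧ + ⟦ y ∧ (not x ∧ a) ⟧ ≡ ⟦ (x xor y) ∧ a ⟧
      xor-split true  true  a = refl
      xor-split true  false a = +-identityʳ ⟦ a ⟧
      xor-split false true  a = +-identityˡ ⟦ a ⟧
      xor-split false false a = refl

-- Derandomised random walks: distant matrices have a cut that tells them apart.

module Walks where

  open Cube
  open Cuts
  open import Data.Bool using (Bool; true; false; not; _∧_; _xor_)
  open import Data.Fin using (Fin; zero; suc; combine; _↑ˡ_; _↑ʳ_)
  open import Data.Integer hiding (suc)
  open import Data.Integer.Properties
  open import Data.Integer.Tactic.RingSolver using (solve-∀)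
  open import Data.Nat as ℕ using (ℕ; zero; suc; z≤n; s≤s)
  import Data.Nat.Properties as ℕ
  open import Data.Product using (∃; ∃₂; _×_; _,_; proj₁; proj₂)
  open import Data.Sum using (_⊎_; inj₁; inj₂)
  open import Data.Vec using (Vec; []; _∷_; lookup)
  open import Function using (_∘_)
  open import Relation.Binary.PropositionalEquality
  open import Relation.Nullary using (yes; no)

  sum-mono : ∀ {n} {f g : Fin n → ℤ} → (∀ i → f i ≤ g i) → sum f ≤ sum g
  sum-mono {zero}  f≤g = ≤-refl
  sum-mono {suc n} f≤g = +-mono-≤ (f≤g zero) (sum-mono (f≤g ∘ suc))

  sum-const : ∀ n c → sum {n} (λ _ → c) ≡ + n * c
  sum-const zero    c = sym (*-zeroˡ c)
  sum-const (suc n) c = trans (cong (_+_ c) (sum-const n c)) (sym (suc-* (+ n) c))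

  sum-combine : ∀ d p (f : Fin (d ℕ.* p) → ℤ) → sum f ≡ sum (λ i → sum (λ j → f (combine {d} {p} i j)))
  sum-combine zero    p f = refl
  sum-combine (suc d) p f = trans (sum-splitAt p f) (cong (_+_ (sum (λ j → f (j ↑ˡ (d ℕ.* p))))) (sum-combine d p (f ∘ (p ↑ʳ_))))

  hamming-sum : ∀ {N} (v w : Vec Bool N) → + hamming v w ≡ sum (λ u → ⟦ lookup v u xor lookup w u ⟧)
  hamming-sum []      []      = refl
  hamming-sum (a ∷ v) (b ∷ w) = cong (_+_ ⟦ a xor b ⟧) (hamming-sum v w)

  matrix : ∀ {d p} → Vec Bool (d ℕ.* p) → Matrix d p
  matrix v i j = lookup v (combine i j)

  ⟦⟧≤1 : ∀ b → ⟦ b ⟧ ≤ 1ℤ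
  ⟦⟧≤1 true  = ≤-refl
  ⟦⟧≤1 false = +≤+ z≤n

  ± : Bool → ℤ
  ± true  = 1ℤ
  ± false = -1ℤ

  -- For a simple random walk z with k steps, both z² − k and
  -- z⁴ − 6kz² + 3k² + 2k are martingales.
  Ψ : ℤ → ℤ → ℤ → ℤ
  Ψ a z k = a * (z * z - k) - (z * z * (z * z) - + 6 * k * (z * z) + + 3 * (k * k) + + 2 * k)

  -- Where the entries agree, neither the position nor the clock moves. Where they differ, this is
  -- the martingale property of both polynomials for one fair ±1 step.
  Ψ-step : ∀ a z k α β → let e = ⟦ α ⟧ - ⟦ β ⟧ in
    Ψ a (z + 1ℤ * e) (k + ⟦ α xor β ⟧) + Ψ a (z + -1ℤ * e) (k + ⟦ α xor β ⟧) ≡ Ψ a z k + Ψ a z k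
  Ψ-step a z k true  true  = cong₂ _+_ (cong₂ (Ψ a) (+-identityʳ z) (+-identityʳ k))
                                       (cong₂ (Ψ a) (+-identityʳ z) (+-identityʳ k))
  Ψ-step a z k false false = cong₂ _+_ (cong₂ (Ψ a) (+-identityʳ z) (+-identityʳ k))
                                       (cong₂ (Ψ a) (+-identityʳ z) (+-identityʳ k))
  Ψ-step a z k true  false = move a z k
    where
    move : ∀ a z k →
      (a * ((z + 1ℤ) * (z + 1ℤ) - (k + 1ℤ)) -
       ((z + 1ℤ) * (z + 1ℤ) * ((z + 1ℤ) * (z + 1ℤ)) - + 6 * (k + 1ℤ) * ((z + 1ℤ) * (z + 1ℤ))
        + + 3 * ((k + 1ℤ) * (k + 1ℤ)) + + 2 * (k + 1ℤ))) +
      (a * ((z + -1ℤ) * (z + -1ℤ) - (k + 1ℤ)) -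
       ((z + -1ℤ) * (z + -1ℤ) * ((z + -1ℤ) * (z + -1ℤ)) - + 6 * (k + 1ℤ) * ((z + -1ℤ) * (z + -1ℤ))
        + + 3 * ((k + 1ℤ) * (k + 1ℤ)) + + 2 * (k + 1ℤ))) ≡
      (a * (z * z - k) - (z * z * (z * z) - + 6 * k * (z * z) + + 3 * (k * k) + + 2 * k)) +
      (a * (z * z - k) - (z * z * (z * z) - + 6 * k * (z * z) + + 3 * (k * k) + + 2 * k))
    move = solve-∀
  Ψ-step a z k false true  = trans (+-comm (Ψ a (z + -1ℤ) (k + 1ℤ)) (Ψ a (z + 1ℤ) (k + 1ℤ))) (Ψ-step a z k true false)

  larger : ∀ {a b c} → a + b ≡ c + c → c ≤ a ⊎ c ≤ b
  larger {a} {b} {c} eq with c ≤? a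
  ... | yes c≤a = inj₁ c≤a
  ... | no  c≰a = inj₂ (+-cancelˡ-≤ c (≤-trans (≤-reflexive (sym eq)) (+-monoˡ-≤ b (<⇒≤ (≰⇒> c≰a)))))
    where
    +-cancelˡ-≤ : ∀ c {a b} → c + a ≤ c + b → a ≤ b
    +-cancelˡ-≤ c {a} {b} h = subst₂ _≤_ (undo c a) (undo c b) (+-monoʳ-≤ (- c) h)
      where
      undo : ∀ c a → - c + (c + a) ≡ a
      undo = solve-∀

  walk : ∀ {d p} → Matrix d p → Matrix d p → (Fin d → Bool) → Fin p → ℤ
  walk A B x j = sum λ i → ± (x i) * (⟦ A i j ⟧ - ⟦ B i j ⟧)

  steps : ∀ {d p} → Matrix d p → Matrix d p → Fin p → ℤ
  steps A B j = sum λ i → ⟦ A i j xor B i j ⟧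

  -- One sign per row moves the walks of all columns simultaneously, so the potential is summed over
  -- the columns. By `Ψ-step` one of the two signs of a row does not lower this sum. General
  -- starting values `z` and `k` are needed for the induction on rows.
  good-signs : ∀ a {d p} (A B : Matrix d p) (z k : Fin p → ℤ) → ∃ λ x →
    sum (λ j → Ψ a (z j) (k j)) ≤ sum (λ j → Ψ a (z j + walk A B x j) (k j + steps A B j))
  good-signs a {zero}  A B z k = (λ ()) , ≤-reflexive
    (sum-cong-≗ λ j → sym (cong₂ (Ψ a) (+-identityʳ (z j)) (+-identityʳ (k j))))
  good-signs a {suc d} {p} A B z k = choose (larger fair)
    where
    z′ : Bool → Fin p → ℤ
    z′ b j = z j + ± b * (⟦ A zero j ⟧ - ⟦ B zero j ⟧)
    k′ : Fin p → ℤ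
    k′ j = k j + ⟦ A zero j xor B zero j ⟧
    total : Bool → ℤ
    total b = sum λ j → Ψ a (z′ b j) (k′ j)

    fair : total true + total false ≡ sum (λ j → Ψ a (z j) (k j)) + sum (λ j → Ψ a (z j) (k j))
    fair = trans (sym (∑-distrib-+ (λ j → Ψ a (z′ true j) (k′ j)) (λ j → Ψ a (z′ false j) (k′ j))))
      (trans (sum-cong-≗ λ j → Ψ-step a (z j) (k j) (A zero j) (B zero j))
             (∑-distrib-+ (λ j → Ψ a (z j) (k j)) (λ j → Ψ a (z j) (k j))))

    extend : Bool → (Fin d → Bool) → Fin (suc d) → Bool
    extend b x zero    = b
    extend b x (suc i) = x i

    continue : ∀ b → sum (λ j → Ψ a (z j) (k j)) ≤ total b → ∃ λ x →
      sum (λ j → Ψ a (z j) (k j)) ≤ sum (λ j → Ψ a (z j + walk A B x j) (k j + steps A B j))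
    continue b up =
      let x , h = good-signs a (A ∘ suc) (B ∘ suc) (z′ b) k′
      in extend b x , ≤-trans up (≤-trans h (≤-reflexive (sum-cong-≗ λ j →
           cong₂ (Ψ a) (+-assoc (z j) _ _) (+-assoc (k j) _ _))))

    choose : sum (λ j → Ψ a (z j) (k j)) ≤ total true ⊎ sum (λ j → Ψ a (z j) (k j)) ≤ total false → ∃ λ x →
      sum (λ j → Ψ a (z j) (k j)) ≤ sum (λ j → Ψ a (z j + walk A B x j) (k j + steps A B j))
    choose (inj₁ up) = continue true up
    choose (inj₂ up) = continue false up

  +-nonNeg : ∀ {i j} → 0ℤ ≤ i → 0ℤ ≤ j → 0ℤ ≤ i + j
  +-nonNeg p q = +-mono-≤ p q

  *-nonNeg : ∀ {i j} → 0ℤ ≤ i → 0ℤ ≤ j → 0ℤ ≤ i * j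
  *-nonNeg {+ m} {+ n} _ _ = ≤-trans (+≤+ z≤n) (≤-reflexive (pos-* m n))

  square-nonNeg : ∀ i → 0ℤ ≤ i * i
  square-nonNeg (+ n)      = *-nonNeg {+ n} {+ n} (+≤+ z≤n) (+≤+ z≤n)
  square-nonNeg (-[1+ n ]) = +≤+ z≤n

  ≤-by-nonNeg : ∀ {i j} r → 0ℤ ≤ r → i + r ≡ j → i ≤ j
  ≤-by-nonNeg {i} r 0≤r refl = subst (_≤ i + r) (+-identityʳ i) (+-monoʳ-≤ i 0≤r)

  ±-abs : ∀ z → ∃ λ y → ± y * z ≡ + ∣ z ∣
  ±-abs (+ n)      = true  , *-identityˡ (+ n)
  ±-abs (-[1+ n ]) = false , *-identityˡ (+ suc n)

  Ψ-abs : ∀ a z k → Ψ a z k ≡ Ψ a (+ ∣ z ∣) k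
  Ψ-abs a (+ n)    k = refl
  Ψ-abs a -[1+ n ] k = refl

  -- u⁴ − 12q²u² + 16q³u = u (u − 2q)² (u + 4q) is nonnegative for u = |z|.
  Ψ-bound : ∀ (q : ℕ) z (k : ℕ) → k ℕ.≤ q ℕ.* q →
    + 6 * (+ q * + q) * + k + Ψ (+ 6 * (+ q * + q)) z (+ k) ≤ + 16 * (+ q * + q * + q) * + ∣ z ∣
  Ψ-bound q z k k≤q² = ≤-trans
    (≤-reflexive (cong (_+_ (+ 6 * (+ q * + q) * + k)) (Ψ-abs (+ 6 * (+ q * + q)) z (+ k))))
    (≤-by-nonNeg
      (+ u * ((+ u - + 2 * + q) * (+ u - + 2 * + q)) * (+ u + + 4 * + q)
        + + 6 * (+ q * + q - + k) * (+ u * + u) + + 3 * (+ k * + k) + + 2 * + k)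
      (+-nonNeg (+-nonNeg (+-nonNeg
        (*-nonNeg (*-nonNeg {+ u} (+≤+ z≤n) (square-nonNeg (+ u - + 2 * + q)))
                  (+-nonNeg {+ u} (+≤+ z≤n) (*-nonNeg {+ 4} {+ q} (+≤+ z≤n) (+≤+ z≤n))))
        (*-nonNeg (*-nonNeg {+ 6} (+≤+ z≤n) (i≤j⇒0≤j-i (≤-trans (+≤+ k≤q²) (≤-reflexive (pos-* q q)))))
                  (square-nonNeg (+ u))))
        (*-nonNeg {+ 3} (+≤+ z≤n) (square-nonNeg (+ k))))
        (*-nonNeg {+ 2} {+ k} (+≤+ z≤n) (+≤+ z≤n)))
      (identity (+ q) (+ k) (+ u)))
    where
    u = ∣ z ∣
    identity : ∀ q k u →
      + 6 * (q * q) * k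
        + (+ 6 * (q * q) * (u * u - k) - (u * u * (u * u) - + 6 * k * (u * u) + + 3 * (k * k) + + 2 * k))
        + (u * ((u - + 2 * q) * (u - + 2 * q)) * (u + + 4 * q)
          + + 6 * (q * q - k) * (u * u) + + 3 * (k * k) + + 2 * k)
      ≡ + 16 * (q * q * q) * u
    identity = solve-∀

  pos-sum : ∀ {n} (f : Fin n → Bool) → ∃ λ k → + k ≡ sum (λ i → ⟦ f i ⟧) × k ℕ.≤ n
  pos-sum {zero}  f = 0 , refl , z≤n
  pos-sum {suc n} f with pos-sum (f ∘ suc) | f zero
  ... | k , eq , k≤n | true  = suc k , cong (_+_ 1ℤ) eq , s≤s k≤n
  ... | k , eq , k≤n | false = k , trans eq (sym (+-identityˡ _)) , ℕ.m≤n⇒m≤1+n k≤n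

  signs-sum : ∀ {n} (z : Fin n → ℤ) → ∃ λ y → sum (λ j → ± (y j) * z j) ≡ sum (λ j → + ∣ z j ∣)
  signs-sum z = (λ j → proj₁ (±-abs (z j))) , sum-cong-≗ (λ j → proj₂ (±-abs (z j)))

  -- This says Σ |z| ≥ 3h / (8q) for matrices at Hamming distance h. The potential starts at 0 and
  -- the chosen `x` keeps it nonnegative; `Ψ-bound` applies in each column because q² rows allow at
  -- most q² steps. `y` holds the signs of the final positions.
  large-walk : ∀ q {p} (A B : Matrix (q ℕ.* q) p) → ∃₂ λ x y →
    + 6 * (+ q * + q) * sum (steps A B) ≤ + 16 * (+ q * + q * + q) * sum (λ j → ± (y j) * walk A B x j)
  large-walk q {p} A B = x , y , (begin
    c * sum (steps A B)
      ≡⟨ +-identityʳ _ ⟨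
    c * sum (steps A B) + 0ℤ
      ≡⟨ cong₂ _+_ (*-distribˡ-sum c (steps A B)) (sym (trans (sum-cong-≗ {p} λ j → Ψ-start c) (sum-replicate-zero p))) ⟩
    sum (λ j → c * steps A B j) + sum {p} (λ j → Ψ c 0ℤ 0ℤ)
      ≤⟨ +-monoʳ-≤ (sum λ j → c * steps A B j) (proj₂ chosen) ⟩
    sum (λ j → c * steps A B j) + sum (λ j → Ψ c (0ℤ + walk A B x j) (0ℤ + steps A B j))
      ≡⟨ ∑-distrib-+ (λ j → c * steps A B j) (λ j → Ψ c (0ℤ + walk A B x j) (0ℤ + steps A B j)) ⟨
    sum (λ j → c * steps A B j + Ψ c (0ℤ + walk A B x j) (0ℤ + steps A B j))
      ≤⟨ sum-mono column ⟩
    sum (λ j → C * + ∣ walk A B x j ∣)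
      ≡⟨ *-distribˡ-sum C (λ j → + ∣ walk A B x j ∣) ⟨
    C * sum (λ j → + ∣ walk A B x j ∣)
      ≡⟨ cong (C *_) (proj₂ (signs-sum (walk A B x))) ⟨
    C * sum (λ j → ± (y j) * walk A B x j) ∎)
    where
    open ≤-Reasoning
    -- The multiplier 6q² of the second moment and the 6k ≤ 6q² from the fourth add up to 12q²u².
    -- With this term, 16 is the least coefficient of q³u that works: the quartic then has a double
    -- root at u = 2q.
    c = + 6 * (+ q * + q)
    C = + 16 * (+ q * + q * + q)
    chosen = good-signs c A B (λ _ → 0ℤ) (λ _ → 0ℤ)
    x = proj₁ chosen
    y = proj₁ (signs-sum (walk A B x))
    Ψ-start : ∀ c → Ψ c 0ℤ 0ℤ ≡ 0ℤ
    Ψ-start c = cong (λ t → t - 0ℤ) (*-zeroʳ c)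
    column : ∀ j → c * steps A B j + Ψ c (0ℤ + walk A B x j) (0ℤ + steps A B j) ≤ C * + ∣ walk A B x j ∣
    column j with pos-sum (λ i → A i j xor B i j)
    ... | k , eq , k≤q² = subst₂ (λ s z → c * s + Ψ c z (0ℤ + s) ≤ C * + ∣ walk A B x j ∣) eq (sym (+-identityˡ (walk A B x j)))
      (subst (λ s → c * + k + Ψ c (walk A B x j) s ≤ C * + ∣ walk A B x j ∣) (sym (+-identityˡ (+ k)))
        (Ψ-bound q (walk A B x j) k k≤q²))

  sum₂ : ∀ {d p} → (Fin d → Fin p → ℤ) → ℤ
  sum₂ f = sum λ i → sum λ j → f i j

  sum₂-+ : ∀ {d p} (f g : Fin d → Fin p → ℤ) → sum₂ (λ i j → f i j + g i j) ≡ sum₂ f + sum₂ g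
  sum₂-+ f g = trans (sum-cong-≗ λ i → ∑-distrib-+ (f i) (g i)) (∑-distrib-+ (λ i → sum (f i)) (λ i → sum (g i)))

  sum₂-cong : ∀ {d p} {f g : Fin d → Fin p → ℤ} → (∀ i j → f i j ≡ g i j) → sum₂ f ≡ sum₂ g
  sum₂-cong f≗g = sum-cong-≗ λ i → sum-cong-≗ λ j → f≗g i j

  module _ {d p} (A B : Matrix d p) (x : Fin d → Bool) (y : Fin p → Bool) where

    -- The sign ± x · ± y is 1 on the pairs separated by (x, not ∘ y) and -1 on those separated by
    -- (x, y). The signed sum of A - B is therefore a difference of two complementary cuts; the
    -- negative terms stand on the left.
    signed-walk : sum (λ j → ± (y j) * walk A B x j) + (cut A x y + cut B x (not ∘ y)) ≡
                  cut A x (not ∘ y) + cut B x y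
    signed-walk = begin
      sum (λ j → ± (y j) * walk A B x j) + (cut A x y + cut B x (not ∘ y))
        ≡⟨ cong₂ _+_ (trans (sum-cong-≗ λ j → *-distribˡ-sum (± (y j)) (λ i → ± (x i) * (⟦ A i j ⟧ - ⟦ B i j ⟧)))
                            (∑-comm λ j i → ± (y j) * (± (x i) * (⟦ A i j ⟧ - ⟦ B i j ⟧))))
                     (sym (sum₂-+ (λ i j → ⟦ (x i xor y j) ∧ A i j ⟧) (λ i j → ⟦ (x i xor not (y j)) ∧ B i j ⟧))) ⟩
      sum₂ (λ i j → ± (y j) * (± (x i) * (⟦ A i j ⟧ - ⟦ B i j ⟧))) +
      sum₂ (λ i j → ⟦ (x i xor y j) ∧ A i j ⟧ + ⟦ (x i xor not (y j)) ∧ B i j ⟧)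
        ≡⟨ sum₂-+ (λ i j → ± (y j) * (± (x i) * (⟦ A i j ⟧ - ⟦ B i j ⟧))) (λ i j → ⟦ (x i xor y j) ∧ A i j ⟧ + ⟦ (x i xor not (y j)) ∧ B i j ⟧) ⟨
      sum₂ (λ i j → ± (y j) * (± (x i) * (⟦ A i j ⟧ - ⟦ B i j ⟧)) + (⟦ (x i xor y j) ∧ A i j ⟧ + ⟦ (x i xor not (y j)) ∧ B i j ⟧))
        ≡⟨ sum₂-cong (λ i j → entry (x i) (y j) (A i j) (B i j)) ⟩
      sum₂ (λ i j → ⟦ (x i xor not (y j)) ∧ A i j ⟧ + ⟦ (x i xor y j) ∧ B i j ⟧)
        ≡⟨ sum₂-+ (λ i j → ⟦ (x i xor not (y j)) ∧ A i j ⟧) (λ i j → ⟦ (x i xor y j) ∧ B i j ⟧) ⟩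
      cut A x (not ∘ y) + cut B x y ∎
      where
      open ≡-Reasoning
      entry : ∀ x y α β → ± y * (± x * (⟦ α ⟧ - ⟦ β ⟧)) + (⟦ (x xor y) ∧ α ⟧ + ⟦ (x xor not y) ∧ β ⟧) ≡
                          ⟦ (x xor not y) ∧ α ⟧ + ⟦ (x xor y) ∧ β ⟧
      entry true  true  true  true  = refl
      entry true  true  true  false = refl
      entry true  true  false true  = refl
      entry true  true  false false = refl
      entry true  false true  true  = refl
      entry true  false true  false = refl
      entry true  false false true  = refl
      entry true  false false false = refl
      entry false true  true  true  = refl
      entry false true  true  false = refl
      entry false true  false true  = refl
      entry false true  false false = refl
      entry false false true  true  = refl
      entry false false true  false = refl
      entry false false false true  = refl
      entry false false false false = refl

  cut-complement-≤ : ∀ {d p} (A : Matrix d p) x y → cut A x y + cut A x (not ∘ y) ≤ + (d ℕ.* p)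
  cut-complement-≤ {d} {p} A x y = begin
    cut A x y + cut A x (not ∘ y)
      ≡⟨ sum₂-+ (λ i j → ⟦ (x i xor y j) ∧ A i j ⟧) (λ i j → ⟦ (x i xor not (y j)) ∧ A i j ⟧) ⟨
    sum₂ (λ i j → ⟦ (x i xor y j) ∧ A i j ⟧ + ⟦ (x i xor not (y j)) ∧ A i j ⟧)
      ≤⟨ sum-mono (λ i → sum-mono λ j → entry (x i) (y j) (A i j)) ⟩
    sum {d} (λ _ → sum {p} (λ _ → 1ℤ))
      ≡⟨ trans (sum-cong-≗ {d} λ _ → trans (sum-const p 1ℤ) (*-identityʳ (+ p))) (sum-const d (+ p)) ⟩
    + d * + p
      ≡⟨ pos-* d p ⟨
    + (d ℕ.* p) ∎
    where
    open ≤-Reasoning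
    entry : ∀ x y α → ⟦ (x xor y) ∧ α ⟧ + ⟦ (x xor not y) ∧ α ⟧ ≤ 1ℤ
    entry true  true  α = ≤-trans (≤-reflexive (+-identityˡ ⟦ α ⟧)) (⟦⟧≤1 α)
    entry true  false α = ≤-trans (≤-reflexive (+-identityʳ ⟦ α ⟧)) (⟦⟧≤1 α)
    entry false true  α = ≤-trans (≤-reflexive (+-identityʳ ⟦ α ⟧)) (⟦⟧≤1 α)
    entry false false α = ≤-trans (≤-reflexive (+-identityˡ ⟦ α ⟧)) (⟦⟧≤1 α)

  -- With ε = a/b, this is what (1 - ε) c ≤ X ≤ (1 + ε) c′ yields once the common estimate X is
  -- eliminated: c ≤ c′ + ε (c + c′).
  Close : ∀ {d p} (a b : ℕ) → Matrix d p → Matrix d p → Set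
  Close a b A B = ∀ x y → + b * cut A x y ≤ + b * cut B x y + + a * (cut A x y + cut B x y)

  -- Both positive terms of `signed-walk` are compared with the negative ones, each at its own cut.
  -- What remains is the error, a times the four cuts involved; these form two complementary pairs,
  -- each at most dp.
  signed-walk-≤ : ∀ a b {d p} (A B : Matrix d p) → Close a b A B → Close a b B A → ∀ x y →
    + b * sum (λ j → ± (y j) * walk A B x j) ≤ + a * (+ 2 * + (d ℕ.* p))
  signed-walk-≤ a b {d} {p} A B A≲B B≲A x y = begin
    + b * Z
      ≡⟨ expand (+ b) Z (cut A x y) (cut B x ȳ) ⟩
    + b * (Z + (cut A x y + cut B x ȳ)) - + b * (cut A x y + cut B x ȳ)
      ≡⟨ cong (λ t → + b * t - + b * (cut A x y + cut B x ȳ)) (signed-walk A B x y) ⟩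
    + b * (cut A x ȳ + cut B x y) - + b * (cut A x y + cut B x ȳ)
      ≡⟨ cong (_- + b * (cut A x y + cut B x ȳ)) (*-distribˡ-+ (+ b) (cut A x ȳ) (cut B x y)) ⟩
    (+ b * cut A x ȳ + + b * cut B x y) - + b * (cut A x y + cut B x ȳ)
      ≤⟨ +-monoˡ-≤ (- (+ b * (cut A x y + cut B x ȳ))) (+-mono-≤ (A≲B x ȳ) (B≲A x y)) ⟩
    ((+ b * cut B x ȳ + + a * (cut A x ȳ + cut B x ȳ)) + (+ b * cut A x y + + a * (cut B x y + cut A x y))) - + b * (cut A x y + cut B x ȳ)
      ≡⟨ regroup (+ a) (+ b) (cut A x y) (cut A x ȳ) (cut B x y) (cut B x ȳ) ⟩
    + a * ((cut A x y + cut A x ȳ) + (cut B x y + cut B x ȳ))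
      ≤⟨ *-monoˡ-≤-nonNeg (+ a) (+-mono-≤ (cut-complement-≤ A x y) (cut-complement-≤ B x y)) ⟩
    + a * (+ (d ℕ.* p) + + (d ℕ.* p))
      ≡⟨ cong (+ a *_) (double (+ (d ℕ.* p))) ⟩
    + a * (+ 2 * + (d ℕ.* p)) ∎
    where
    open ≤-Reasoning
    Z = sum (λ j → ± (y j) * walk A B x j)
    ȳ = not ∘ y
    expand : ∀ b z s t → b * z ≡ b * (z + (s + t)) - b * (s + t)
    expand = solve-∀
    regroup : ∀ a b c c′ e e′ →
      ((b * e′ + a * (c′ + e′)) + (b * c + a * (e + c))) - b * (c + e′) ≡ a * ((c + c′) + (e + e′))
    regroup = solve-∀
    double : ∀ m → m + m ≡ + 2 * m
    double = solve-∀

  hamming-matrix : ∀ {d p} (v w : Vec Bool (d ℕ.* p)) →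
    + hamming v w ≡ sum (steps (matrix {d} {p} v) (matrix {d} {p} w))
  hamming-matrix {d} {p} v w = trans (hamming-sum v w)
    (trans (sum-combine d p (λ u → ⟦ lookup v u xor lookup w u ⟧))
           (∑-comm λ i j → ⟦ matrix {d} {p} v i j xor matrix {d} {p} w i j ⟧))

  -- Let N = q²p. `large-walk` and `signed-walk-≤` give 6q²hb ≤ 32q³aN, and b ≥ 64qa turns this into
  -- 12h ≤ N, more than the required 8h ≤ N.
  close⇒hamming-≤ : ∀ q p a b → 0 ℕ.< q → 0 ℕ.< a → 64 ℕ.* (q ℕ.* a) ℕ.≤ b →
    (v w : Vec Bool (q ℕ.* q ℕ.* p)) →
    Close {q ℕ.* q} {p} a b (matrix v) (matrix w) → Close {q ℕ.* q} {p} a b (matrix w) (matrix v) →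
    8 ℕ.* hamming v w ℕ.≤ q ℕ.* q ℕ.* p
  close⇒hamming-≤ q@(suc _) p a@(suc _) b _ _ 64qa≤b v w v≲w w≲v = ℕ.≤-trans (ℕ.*-monoˡ-≤ (hamming v w) (ℕ.m≤m+n 8 4))
    (drop‿+≤+ (≤-trans (≤-reflexive (pos-* 12 (hamming v w)))
      (*-cancelˡ-≤-pos (+ 12 * + hamming v w) (+ n) (+ 32 * (+ q * + q * + q) * + a) main)))
    where
    n = q ℕ.* q ℕ.* p
    A = matrix {q ℕ.* q} {p} v
    B = matrix {q ℕ.* q} {p} w
    far = large-walk q A B
    x = proj₁ far
    y = proj₁ (proj₂ far)
    Z = sum (λ j → ± (y j) * walk A B x j)
    H = + hamming v w
    open ≤-Reasoning
    main : + 32 * (+ q * + q * + q) * + a * (+ 12 * H) ≤ + 32 * (+ q * + q * + q) * + a * + n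
    main = begin
      + 32 * (+ q * + q * + q) * + a * (+ 12 * H)     ≡⟨ regroup₁ (+ q) (+ a) H ⟩
      + 64 * (+ q * + a) * (+ 6 * (+ q * + q) * H)    ≡⟨ cong (λ t → + 64 * t * (+ 6 * (+ q * + q) * H)) (pos-* q a) ⟨
      + 64 * + (q ℕ.* a) * (+ 6 * (+ q * + q) * H)    ≡⟨ cong (_* (+ 6 * (+ q * + q) * H)) (pos-* 64 (q ℕ.* a)) ⟨
      + (64 ℕ.* (q ℕ.* a)) * (+ 6 * (+ q * + q) * H)
        ≤⟨ *-monoʳ-≤-nonNeg (+ 6 * (+ q * + q) * H)
             {{nonNegative (*-nonNeg {+ 6 * (+ q * + q)} {H} (+≤+ z≤n) (+≤+ z≤n))}} (+≤+ 64qa≤b) ⟩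
      + b * (+ 6 * (+ q * + q) * H)                   ≡⟨ cong (λ t → + b * (+ 6 * (+ q * + q) * t)) (hamming-matrix {q ℕ.* q} {p} v w) ⟩
      + b * (+ 6 * (+ q * + q) * sum (steps A B))     ≤⟨ *-monoˡ-≤-nonNeg (+ b) (proj₂ (proj₂ far)) ⟩
      + b * (+ 16 * (+ q * + q * + q) * Z)            ≡⟨ regroup₂ (+ b) (+ q) Z ⟩
      + 16 * (+ q * + q * + q) * (+ b * Z)            ≤⟨ *-monoˡ-≤-nonNeg (+ 16 * (+ q * + q * + q)) (signed-walk-≤ a b A B v≲w w≲v x y) ⟩
      + 16 * (+ q * + q * + q) * (+ a * (+ 2 * + n))  ≡⟨ regroup₃ (+ q) (+ a) (+ n) ⟩
      + 32 * (+ q * + q * + q) * + a * + n            ∎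
      where
      regroup₁ : ∀ q a h → + 32 * (q * q * q) * a * (+ 12 * h) ≡ + 64 * (q * a) * (+ 6 * (q * q) * h)
      regroup₁ = solve-∀
      regroup₂ : ∀ b q z → b * (+ 16 * (q * q * q) * z) ≡ + 16 * (q * q * q) * (b * z)
      regroup₂ = solve-∀
      regroup₃ : ∀ q a n → + 16 * (q * q * q) * (a * (+ 2 * n)) ≡ + 32 * (q * q * q) * a * n
      regroup₃ = solve-∀

-- The size bound for a rational error a/b.

module SizeBound where

  open import Defs
  open Cube
  open SketchCount
  open Cuts
  open Walks
  open import Data.Bool using (Bool; true; false; _∧_; _xor_)
  import Data.Bool.Properties as Bool
  open import Data.Fin as Fin using (Fin; zero; suc)
  import Data.Integer as ℤ
  import Data.Integer.Properties as ℤ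
  open import Data.Nat
  open import Data.Nat.DivMod
  open import Data.Nat.Properties
  open import Data.Nat.Tactic.RingSolver using (solve-∀)
  open import Data.Product using (proj₁; proj₂)
  import Data.Rational as ℚ
  open import Data.Sum using ([_,_]′)
  open import Data.Vec as Vec using (Vec; []; _∷_; tabulate)
  open import Function using (_∘_)
  open import Relation.Binary.PropositionalEquality
  open import Relation.Nullary using (does; contradiction)
  open import Relation.Nullary.Decidable using (from-yes)

  -- Agreement of all cuts up to the relative error a/b, with denominators cleared.
  Near : ∀ {n} → ℕ → ℕ → Graph n → Graph n → Set
  Near a b G H = ∀ S → b * cutSize G S ≤ b * cutSize H S + a * (cutSize G S + cutSize H S)

  near⇒close : ∀ a b {d p} (A B : Matrix d p) → Near a b (bipartite A) (bipartite B) → Close a b A B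
  near⇒close a b A B near x y = subst₂ (λ c e → ℤ.+ b ℤ.* c ℤ.≤ ℤ.+ b ℤ.* e ℤ.+ ℤ.+ a ℤ.* (c ℤ.+ e))
    (cutSize-bipartite A x y) (cutSize-bipartite B x y)
    (subst₂ ℤ._≤_ (ℤ.pos-* b c) (cong₂ ℤ._+_ (ℤ.pos-* b e) (ℤ.pos-* a (c + e))) (ℤ.+≤+ (near S)))
    where
    S = tabulate x Vec.++ tabulate y
    c = cutSize (bipartite A) S
    e = cutSize (bipartite B) S

  sum-point : ∀ {p} (j : Fin p) (f : Fin p → Bool) → sum (λ k → ⟦ does (j Fin.≟ k) ∧ f k ⟧) ≡ ⟦ f j ⟧
  sum-point {suc p} zero    f = trans (cong (ℤ._+_ ⟦ f zero ⟧) (sum-replicate-zero p)) (ℤ.+-identityʳ _)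
  sum-point {suc p} (suc j) f = trans (ℤ.+-identityˡ _) (sum-point j (f ∘ suc))

  -- A multiplicative error below 1 still tells empty cuts from nonempty ones.
  near⇒entry-≤ : ∀ {a b} → a < b → ∀ {p} (A B : Matrix 1 p) →
    Near a b (bipartite A) (bipartite B) → ∀ j → A zero j ≡ true → B zero j ≡ true
  near⇒entry-≤ {a} {b} a<b A B near j Aj with B zero j in Bj
  ... | true  = refl
  ... | false = contradiction (subst₂ _≤_ (*-identityʳ b) rhs
    (subst₂ (λ c e → b * c ≤ b * e + a * (c + e)) (entry A Aj) (entry B Bj) (near S))) (<⇒≱ a<b)
    where
    S = tabulate {n = 1} (λ _ → false) Vec.++ tabulate (λ k → does (j Fin.≟ k))
    entry : ∀ A {c} → A zero j ≡ c → cutSize (bipartite A) S ≡ 𝟙 c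
    entry A refl = ℤ.+-injective (trans (cutSize-bipartite A (λ _ → false) (λ k → does (j Fin.≟ k)))
      (trans (ℤ.+-identityʳ _) (sum-point j (A zero))))
    rhs : b * 0 + a * 1 ≡ a
    rhs = trans (cong (_+ a * 1) (*-zeroʳ b)) (*-identityʳ a)

  near⇒entry-≡ : ∀ {a b} → a < b → ∀ {p} (A B : Matrix 1 p) →
    Near a b (bipartite A) (bipartite B) → Near a b (bipartite B) (bipartite A) → ∀ j → A zero j ≡ B zero j
  near⇒entry-≡ a<b A B A≲B B≲A j with A zero j in Aj | B zero j in Bj
  ... | true  | true  = refl
  ... | false | false = refl
  ... | true  | false = trans (sym (near⇒entry-≤ a<b A B A≲B j Aj)) Bj
  ... | false | true  = trans (sym Aj) (near⇒entry-≤ a<b B A B≲A j Bj)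

  hamming-self : ∀ {N} (v : Vec Bool N) → hamming v v ≡ 0
  hamming-self []          = refl
  hamming-self (true ∷ v)  = hamming-self v
  hamming-self (false ∷ v) = hamming-self v

  strings≤-< : ∀ s → strings≤ s < 2 ^ suc s
  strings≤-< zero    = s≤s (s≤s z≤n)
  strings≤-< (suc s) = begin-strict
    1 + (strings≤ s + strings≤ s)  <⟨ n<1+n _ ⟩
    2 + (strings≤ s + strings≤ s)  ≡⟨ double (strings≤ s) ⟩
    suc (strings≤ s) + (suc (strings≤ s) + 0) ≤⟨ *-monoʳ-≤ 2 (strings≤-< s) ⟩
    2 ^ suc (suc s) ∎
    where
    open ≤-Reasoning
    double : ∀ t → 2 + (t + t) ≡ suc t + (suc t + 0)
    double = solve-∀

  ^-distribʳ-* : ∀ k m n → (m * n) ^ k ≡ m ^ k * n ^ k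
  ^-distribʳ-* zero    m n = refl
  ^-distribʳ-* (suc k) m n = trans (cong (m * n *_) (^-distribʳ-* k m n)) (medial m n (m ^ k) (n ^ k))
    where
    medial : ∀ a b c d → a * b * (c * d) ≡ a * c * (b * d)
    medial = solve-∀

  ^-cancelʳ-≤ : ∀ m n → 2 ^ m ≤ 2 ^ n → m ≤ n
  ^-cancelʳ-≤ m n h = ≮⇒≥ λ n<m → <⇒≱ (^-monoʳ-< 2 (s≤s (s≤s z≤n)) n<m) h

  -- As r is at most N/8, the eighth power turns z^r into at most z^N, leaving a comparison of N-th
  -- powers of fixed numbers.
  eighth-power : ∀ N r t x y z .{{_ : NonZero z}} → 8 * r ≤ N →
    x ^ N ≤ 2 ^ t * (y ^ N * z ^ r) → (x ^ 8) ^ N ≤ 2 ^ (t * 8) * (y ^ 8 * z) ^ N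
  eighth-power N r t x y z 8r≤N h = begin
    (x ^ 8) ^ N                                ≡⟨ swap-powers x 8 N ⟩
    (x ^ N) ^ 8                                ≤⟨ ^-monoˡ-≤ 8 h ⟩
    (2 ^ t * (y ^ N * z ^ r)) ^ 8              ≡⟨ ^-distribʳ-* 8 (2 ^ t) (y ^ N * z ^ r) ⟩
    (2 ^ t) ^ 8 * (y ^ N * z ^ r) ^ 8          ≡⟨ cong₂ _*_ (^-*-assoc 2 t 8) (^-distribʳ-* 8 (y ^ N) (z ^ r)) ⟩
    2 ^ (t * 8) * ((y ^ N) ^ 8 * (z ^ r) ^ 8)  ≡⟨ cong (2 ^ (t * 8) *_) (cong₂ _*_ (swap-powers y N 8) (trans (^-*-assoc z r 8) (cong (z ^_) (*-comm r 8)))) ⟩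
    2 ^ (t * 8) * ((y ^ 8) ^ N * z ^ (8 * r))  ≤⟨ *-monoʳ-≤ (2 ^ (t * 8)) (*-monoʳ-≤ ((y ^ 8) ^ N) (^-monoʳ-≤ z 8r≤N)) ⟩
    2 ^ (t * 8) * ((y ^ 8) ^ N * z ^ N)        ≡⟨ cong (2 ^ (t * 8) *_) (^-distribʳ-* N (y ^ 8) z) ⟨
    2 ^ (t * 8) * (y ^ 8 * z) ^ N              ∎
    where
    open ≤-Reasoning
    swap-powers : ∀ m k l → (m ^ k) ^ l ≡ (m ^ l) ^ k
    swap-powers m k l = trans (^-*-assoc m k l) (trans (cong (m ^_) (*-comm k l)) (sym (^-*-assoc m l k)))

  exponent-≤ : ∀ N e K u .{{_ : NonZero K}} → 2 ^ 3 * K ≤ u → u ^ N ≤ 2 ^ e * K ^ N → 3 * N ≤ e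
  exponent-≤ N e K u 8K≤u h = ^-cancelʳ-≤ (3 * N) e (*-cancelʳ-≤ (2 ^ (3 * N)) (2 ^ e) (K ^ N) {{m^n≢0 K N}} (begin
    2 ^ (3 * N) * K ^ N     ≡⟨ cong (_* K ^ N) (^-*-assoc 2 3 N) ⟨
    (2 ^ 3) ^ N * K ^ N     ≡⟨ ^-distribʳ-* N (2 ^ 3) K ⟨
    (2 ^ 3 * K) ^ N         ≤⟨ ^-monoˡ-≤ N 8K≤u ⟩
    u ^ N                   ≤⟨ h ⟩
    2 ^ e * K ^ N           ∎))
    where open ≤-Reasoning

  -- Eighth powers turn the entropy estimate 2³ · 4⁸ · 3 ≤ 6⁸ into a bound on N.
  dimension-bound : ∀ N s r → 0 < s → 8 * r ≤ N →
    5 * 2 ^ N * 3 ^ N ≤ 8 * (strings≤ s * (4 ^ N * 3 ^ r)) → N ≤ 14 * s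
  dimension-bound N s r 0<s 8r≤N h = *-cancelˡ-≤ 3 (begin
    3 * N             ≤⟨ exponent-≤ N ((4 + s) * 8) (4 ^ 8 * 3) (6 ^ 8) (from-yes (2 ^ 3 * (4 ^ 8 * 3) ≤? 6 ^ 8))
                           (eighth-power N r (4 + s) 6 4 3 8r≤N root) ⟩
    (4 + s) * 8       ≡⟨ expand s ⟩
    -- Positivity of `s` absorbs the additive constant; 40 is then rounded up to 42, a multiple of
    -- 3.
    32 * 1 + 8 * s    ≤⟨ +-monoˡ-≤ (8 * s) (*-monoʳ-≤ 32 0<s) ⟩
    32 * s + 8 * s    ≡⟨ *-distribʳ-+ s 32 8 ⟨
    40 * s            ≤⟨ *-monoˡ-≤ s (m≤m+n 40 2) ⟩
    42 * s            ≡⟨ *-assoc 3 14 s ⟩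
    3 * (14 * s)      ∎)
    where
    open ≤-Reasoning
    expand : ∀ s → (4 + s) * 8 ≡ 32 * 1 + 8 * s
    expand = solve-∀
    root : 6 ^ N ≤ 2 ^ (4 + s) * (4 ^ N * 3 ^ r)
    root = begin
      6 ^ N                                  ≡⟨ ^-distribʳ-* N 2 3 ⟩
      2 ^ N * 3 ^ N                          ≤⟨ m≤n*m (2 ^ N * 3 ^ N) 5 ⟩
      5 * (2 ^ N * 3 ^ N)                    ≡⟨ *-assoc 5 (2 ^ N) (3 ^ N) ⟨
      5 * 2 ^ N * 3 ^ N                      ≤⟨ h ⟩
      8 * (strings≤ s * (4 ^ N * 3 ^ r))     ≤⟨ *-monoʳ-≤ 8 (*-monoˡ-≤ (4 ^ N * 3 ^ r) (<⇒≤ (strings≤-< s))) ⟩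
      8 * (2 ^ suc s * (4 ^ N * 3 ^ r))      ≡⟨ *-assoc 8 (2 ^ suc s) _ ⟨
      8 * 2 ^ suc s * (4 ^ N * 3 ^ r)        ≡⟨ cong (_* (4 ^ N * 3 ^ r)) (^-distribˡ-+-* 2 3 (suc s)) ⟨
      2 ^ (3 + suc s) * (4 ^ N * 3 ^ r)      ≡⟨ cong (λ t → 2 ^ t * (4 ^ N * 3 ^ r)) (+-suc 3 s) ⟩
      2 ^ (4 + s) * (4 ^ N * 3 ^ r)          ∎

  -- In terms of ε = a/b: n/ε² ≤ 2p · c²q² ≤ 2kc² · s. Here `k` comes from `dimension-bound` and `c`
  -- measures how far q falls short of 1/ε.
  volume-bound : ∀ {n a b s} p q k c {K} → n ≤ 2 * p → b ≤ c * (q * a) → q * q * p ≤ k * s →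
    2 * k * (c * c) ≤ K → n * (b * b) ≤ K * (s * (a * a))
  volume-bound {n} {a} {b} {s} p q k c {K} n≤2p b≤cqa q²p≤ks C≤K = begin
    n * (b * b)                              ≤⟨ *-mono-≤ n≤2p (*-mono-≤ b≤cqa b≤cqa) ⟩
    2 * p * (c * (q * a) * (c * (q * a)))    ≡⟨ collect₁ p q c a ⟩
    q * q * p * (2 * (c * c) * (a * a))      ≤⟨ *-monoˡ-≤ (2 * (c * c) * (a * a)) q²p≤ks ⟩
    k * s * (2 * (c * c) * (a * a))          ≡⟨ collect₂ k s c a ⟩
    2 * k * (c * c) * (s * (a * a))          ≤⟨ *-monoˡ-≤ (s * (a * a)) C≤K ⟩
    K * (s * (a * a))                        ∎
    where
    open ≤-Reasoning
    collect₁ : ∀ p q c a → 2 * p * (c * (q * a) * (c * (q * a))) ≡ q * q * p * (2 * (c * c) * (a * a))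
    collect₁ = solve-∀
    collect₂ : ∀ k s c a → k * s * (2 * (c * c) * (a * a)) ≡ 2 * k * (c * c) * (s * (a * a))
    collect₂ = solve-∀

  opaque

    -- Opaque, because unfolding a product with this literal is infeasible.
    size-constant : ℕ
    size-constant = 2 ^ 19

    size-constant-large : 2 * 14 * (128 * 128) ≤ size-constant
    size-constant-large = from-yes (2 * 14 * (128 * 128) ≤? 2 ^ 19)

  module Bounds {n : ℕ} (sk : SketchAlg n) (A : Graph n → Coins → Set)
    (likely : ∀ G → Probability≥ (ℤ.+ 3 ℚ./ 4) (A G)) (s : ℕ) (short : WorstCaseSize≤ sk s)
    (a b : ℕ) (near : ∀ ω G H → A G ω → A H ω → sk ω G ≡ sk ω H → Near a b G H) where

    family-bound : ∀ {N} (G : Vec Bool N → Graph n) ℓ r → 0 < ℓ →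
      (∀ v w → Near a b (G v) (G w) → Near a b (G w) (G v) → hamming v w ≤ r) →
      5 * 2 ^ N * ℓ ^ N ≤ 8 * (strings≤ s * (suc ℓ ^ N * ℓ ^ r))
    family-bound G ℓ r 0<ℓ separated = sketch-bound (A ∘ G) (likely ∘ G) (λ ω → sk ω ∘ G) s
      (λ ω v → short (G v) ω) ℓ r 0<ℓ
      λ ω v w Av Aw eq → separated v w (near ω (G v) (G w) Av Aw eq) (near ω (G w) (G v) Aw Av (sym eq))

    -- Supplies the 0 < s with which `dimension-bound` absorbs its additive constant. With s = 0 the
    -- empty and the full star would share their only possible sketch.
    1≤size : ∀ p → n ≡ 1 + p → 0 < p → a < b → 0 < s
    -- At N = 1, r = 0 and s = 0 the family bound reads 10ℓ ≤ 8(ℓ + 1), which fails from ℓ = 5 on: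
    -- 50 against 48.
    1≤size p@(suc _) refl _ a<b = n≢0⇒n>0 λ { refl →
      <⇒≱ (from-yes (48 <? 50)) (family-bound (bipartite {1} {p} ∘ constant) 5 0 (s≤s z≤n) separated) }
      where
      constant : Vec Bool 1 → Matrix 1 p
      constant (c ∷ []) _ _ = c
      separated : ∀ v w → Near a b (bipartite (constant v)) (bipartite (constant w)) →
        Near a b (bipartite (constant w)) (bipartite (constant v)) → hamming v w ≤ 0
      separated v@(c ∷ []) w@(e ∷ []) v≲w w≲v with near⇒entry-≡ a<b (constant v) (constant w) v≲w w≲v zero
      ... | refl = ≤-reflexive (hamming-self v)

    star-bound : ∀ p → n ≡ 1 + p → 0 < p → a < b → p ≤ 14 * s
    star-bound p refl 0<p a<b = subst (_≤ 14 * s) (*-identityˡ p)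
      (dimension-bound (1 * p) s 0 (1≤size p refl 0<p a<b) z≤n
        (family-bound (bipartite ∘ matrix {1} {p}) 3 0 (s≤s z≤n) separated))
      where
      separated : ∀ v w → Near a b (bipartite (matrix {1} {p} v)) (bipartite (matrix {1} {p} w)) →
        Near a b (bipartite (matrix {1} {p} w)) (bipartite (matrix {1} {p} v)) → hamming v w ≤ 0
      separated v w v≲w w≲v = ≤-reflexive (ℤ.+-injective (trans (hamming-matrix {1} {p} v w)
        (trans (sum-cong-≗ λ j → trans (ℤ.+-identityʳ _)
          (cong ⟦_⟧ (trans (cong (_xor matrix {1} {p} w zero j) (near⇒entry-≡ a<b (matrix {1} {p} v) (matrix {1} {p} w) v≲w w≲v j))
                           (Bool.xor-same (matrix {1} {p} w zero j)))))
          (sum-replicate-zero p))))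

    -- The weight ℓ = 3 gives 6⁸ / (4⁸ · 3) ≈ 8.5, above 2³. The optimal Chernoff weight for radius
    -- N/8 would be ℓ = 7, with ratio about 12.6, which gains no further power of two.
    bipartite-bound : ∀ q p → n ≡ q * q + p → 0 < q → 0 < a → 0 < s → 64 * (q * a) ≤ b → q * q * p ≤ 14 * s
    bipartite-bound q p refl 0<q 0<a 0<s 64qa≤b =
      dimension-bound (q * q * p) s (q * q * p / 8) 0<s
        (≤-trans (≤-reflexive (*-comm 8 (q * q * p / 8))) (m/n*n≤m (q * q * p) 8))
        (family-bound (bipartite ∘ matrix {q * q} {p}) 3 (q * q * p / 8) (s≤s z≤n) λ v w v≲w w≲v →
          ≤-trans (≤-reflexive (sym (m*n/n≡m (hamming v w) 8))) (/-monoˡ-≤ 8 (≤-trans (≤-reflexive (*-comm (hamming v w) 8))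
            (close⇒hamming-≤ q p a b 0<q 0<a 64qa≤b v w
              (near⇒close a b (matrix v) (matrix w) v≲w) (near⇒close a b (matrix w) (matrix v) w≲v)))))

    module TwoVertices (a<b : a < b) (b²<na² : b * b < n * (a * a)) where

      private
        2≤n : 2 ≤ n
        2≤n = ≮⇒≥ λ n<2 → <⇒≱ b²<na² (begin
          n * (a * a)   ≤⟨ *-monoˡ-≤ (a * a) (s≤s⁻¹ n<2) ⟩
          1 * (a * a)   ≡⟨ *-identityˡ (a * a) ⟩
          a * a         ≤⟨ *-mono-≤ (<⇒≤ a<b) (<⇒≤ a<b) ⟩
          b * b         ∎)
          where open ≤-Reasoning

      p : ℕ
      p = suc (proj₁ (m≤n⇒∃[o]m+o≡n 2≤n))

      n≡1+p : n ≡ 1 + p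
      n≡1+p = sym (proj₂ (m≤n⇒∃[o]m+o≡n 2≤n))

    -- Here 1/ε ≤ 64, so n/ε² is linear in n and the p = n - 1 bits of a star are enough.
    large-error : 0 < a → a < b → b * b < n * (a * a) → b ≤ 64 * a → n * (b * b) ≤ size-constant * (s * (a * a))
    large-error 0<a a<b b²<na² b≤64a = volume-bound {a = a} {s = s} p 1 14 64 {size-constant} n≤2p
      (≤-trans b≤64a (*-monoʳ-≤ 64 (≤-reflexive (sym (*-identityˡ a)))))
      (≤-trans (≤-reflexive (*-identityˡ p)) (star-bound p n≡1+p (s≤s z≤n) a<b))
      (≤-trans (from-yes (2 * 14 * (64 * 64) ≤? 2 * 14 * (128 * 128))) size-constant-large)
      where
      open TwoVertices a<b b²<na²
      n≤2p : n ≤ 2 * p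
      n≤2p = ≤-trans (≤-reflexive n≡1+p) (+-mono-≤ {1} {p} (s≤s z≤n) (≤-reflexive (sym (+-identityʳ p))))

    -- q = ⌊1/(64ε)⌋ is the largest value that `close⇒hamming-≤` admits. It is at least 1, so
    -- rounding down loses at most a factor 2, whence b ≤ 128qa.
    small-error : 0 < a → a < b → b * b < n * (a * a) → 64 * a ≤ b → n * (b * b) ≤ size-constant * (s * (a * a))
    small-error 0<a a<b b²<na² 64a≤b = volume-bound {a = a} {s = s} p q 14 128 {size-constant} n≤2p b≤128qa
      (bipartite-bound q p (sym q²+p≡n) 0<q 0<a (1≤size _ n≡1+p (s≤s z≤n) a<b) 64qa≤b)
      size-constant-large
      where
      open ≤-Reasoning
      open TwoVertices a<b b²<na² using (n≡1+p)
      instance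
        64a≢0 : NonZero (64 * a)
        64a≢0 = >-nonZero (≤-trans 0<a (m≤n*m a 64))
      q = b / (64 * a)
      0<q : 0 < q
      0<q = m≥n⇒m/n>0 64a≤b
      64qa≤b : 64 * (q * a) ≤ b
      64qa≤b = ≤-trans (≤-reflexive (rotate 64 q a)) (m/n*n≤m b (64 * a))
        where
        rotate : ∀ c q a → c * (q * a) ≡ q * (c * a)
        rotate = solve-∀
      b≤128qa : b ≤ 128 * (q * a)
      b≤128qa = begin
        b                               ≡⟨ m≡m%n+[m/n]*n b (64 * a) ⟩
        b % (64 * a) + q * (64 * a)     ≤⟨ +-monoˡ-≤ (q * (64 * a)) (<⇒≤ (m%n<n b (64 * a))) ⟩
        64 * a + q * (64 * a)           ≤⟨ +-monoˡ-≤ (q * (64 * a)) (m≤n*m (64 * a) q {{>-nonZero 0<q}}) ⟩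
        q * (64 * a) + q * (64 * a)     ≡⟨ double 64 q a ⟩
        2 * 64 * (q * a)                ∎
        where
        double : ∀ c q a → q * (c * a) + q * (c * a) ≡ 2 * c * (q * a)
        double = solve-∀
      -- Here ε > 1/√n enters: 64²q² ≤ 1/ε² < n, so the part of size q² takes up at most half of the
      -- vertices.
      2q²≤n : 2 * (q * q) ≤ n
      2q²≤n = ≤-trans (*-monoˡ-≤ (q * q) (from-yes (2 ≤? 64 * 64))) (<⇒≤ (*-cancelʳ-< (a * a) _ _ (begin-strict
        64 * 64 * (q * q) * (a * a)     ≡⟨ square 64 q a ⟩
        64 * (q * a) * (64 * (q * a))   ≤⟨ *-mono-≤ 64qa≤b 64qa≤b ⟩
        b * b                           <⟨ b²<na² ⟩
        n * (a * a)                     ∎)))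
        where
        square : ∀ c q a → c * c * (q * q) * (a * a) ≡ c * (q * a) * (c * (q * a))
        square = solve-∀
      q²≤n : q * q ≤ n
      q²≤n = ≤-trans (m≤n*m (q * q) 2) 2q²≤n
      p = proj₁ (m≤n⇒∃[o]m+o≡n q²≤n)
      q²+p≡n : q * q + p ≡ n
      q²+p≡n = proj₂ (m≤n⇒∃[o]m+o≡n q²≤n)
      n≤2p : n ≤ 2 * p
      n≤2p = begin
        n           ≡⟨ q²+p≡n ⟨
        q * q + p   ≤⟨ +-monoˡ-≤ p (+-cancelˡ-≤ (q * q) (q * q) p (begin
          q * q + q * q   ≡⟨ cong (q * q +_) (+-identityʳ (q * q)) ⟨
          2 * (q * q)     ≤⟨ 2q²≤n ⟩
          n               ≡⟨ q²+p≡n ⟨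
          q * q + p       ∎)) ⟩
        p + p       ≡⟨ cong (p +_) (+-identityʳ p) ⟨
        2 * p       ∎

    size-bound : 0 < a → a < b → b * b < n * (a * a) → n * (b * b) ≤ size-constant * (s * (a * a))
    size-bound 0<a a<b b²<na² = [ large-error 0<a a<b b²<na² , small-error 0<a a<b b²<na² ]′ (≤-total b (64 * a))

-- Real errors, approximated from above by rationals.

module RealBound where

  open import Defs
  open CoinSelection
  open SizeBound using (Near; module Bounds; size-constant; size-constant-large)
  import Data.Integer as ℤ
  import Data.Integer.Properties as ℤ
  open import Data.Integer.Tactic.RingSolver using (solve-∀)
  open import Data.Nat as ℕ using (ℕ; zero; suc; z≤n; s≤s)
  import Data.Nat.Properties as ℕ
  open import Data.Product using (∃; ∃₂; _×_; _,_; proj₁; proj₂)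
  open import Data.Rational
  open import Data.Rational.Properties
  import Data.Rational.Unnormalised as ℚᵘ
  import Data.Rational.Unnormalised.Properties as ℚᵘ
  open import Data.Rational.Solver using (module +-*-Solver)
  open import Data.Sum using (inj₁; inj₂)
  open import Relation.Binary.PropositionalEquality
  open import Relation.Nullary using (yes; no; contradiction)

  ι-nonNeg : ∀ n → NonNegative (ι n)
  ι-nonNeg n = nonNegative (ι-mono-≤ {0} {n} z≤n)

  ι-pos : ∀ {n} → 0 ℕ.< n → Positive (ι n)
  ι-pos {n} 0<n = positive (≰⇒> λ ιn≤0 → ℕ.<⇒≱ 0<n (ι-cancel-≤ {n} {0} ιn≤0))

  fraction : ∀ e → 0ℚ < e → ∃₂ λ a b → 0 ℕ.< a × 0 ℕ.< b × ι b * e ≡ ι a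
  fraction (mkℚ (ℤ.+ zero) d _) 0<e = contradiction 0<e λ { (*<* (ℤ.+<+ ())) }
  fraction (mkℚ ℤ.-[1+ _ ] d _) 0<e = contradiction 0<e λ { (*<* ()) }
  fraction e@(mkℚ (ℤ.+ suc a) d _) _ = suc a , suc d , s≤s z≤n , s≤s z≤n , toℚᵘ-injective (begin
    toℚᵘ (ι (suc d) * e)                                ≈⟨ toℚᵘ-homo-* (ι (suc d)) e ⟩
    toℚᵘ (ι (suc d)) ℚᵘ.* ℚᵘ.mkℚᵘ (ℤ.+ suc a) d         ≈⟨ ℚᵘ.*-congʳ (toℚᵘ-ι (suc d)) ⟩
    ℚᵘ.mkℚᵘ (ℤ.+ suc d) 0 ℚᵘ.* ℚᵘ.mkℚᵘ (ℤ.+ suc a) d    ≈⟨ ℚᵘ.*≡* (cancel (ℤ.+ suc d) (ℤ.+ suc a)) ⟩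
    ℚᵘ.mkℚᵘ (ℤ.+ suc a) 0                               ≈⟨ ℚᵘ.≃-sym (toℚᵘ-ι (suc a)) ⟩
    toℚᵘ (ι (suc a))                                    ∎)
    where
    open ℚᵘ.≃-Reasoning
    cancel : ∀ i j → i ℤ.* j ℤ.* ℤ.1ℤ ≡ j ℤ.* (ℤ.1ℤ ℤ.* i)
    cancel = solve-∀

  ½*-< : ∀ {δ} → 0ℚ < δ → ½ * δ < δ
  ½*-< {δ} 0<δ = subst₂ _<_ (+-identityʳ (½ * δ)) (½+½ δ) (+-monoʳ-< (½ * δ) (½-pos 0<δ))

  ≤-from-slack : ∀ {p q} → (∀ δ → 0ℚ < δ → p ≤ q + (δ + δ)) → p ≤ q
  ≤-from-slack {p} {q} h with p ≤? q
  ... | yes p≤q = p≤q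
  ... | no  p≰q = contradiction (<-≤-trans q+½g<p (h (½ * (½ * g)) (½-pos (½-pos 0<g)))) (<-irrefl (cong (q +_) (sym (½+½ (½ * g)))))
    where
    g = p - q
    back : ∀ q p → q + (p - q) ≡ p
    back = solve 2 (λ q p → q :+ (p :- q) := p) refl
      where open +-*-Solver
    0<g : 0ℚ < g
    0<g = subst (_< g) (+-inverseʳ q) (+-monoˡ-< (- q) (≰⇒> p≰q))
    q+½g<p : q + ½ * g < p
    q+½g<p = subst (q + ½ * g <_) (back q p) (+-monoʳ-< q (½*-< 0<g))

  module _ {n} (sk : SketchAlg n) (est : EstimateAlg n) (ε : ℝ) (e : ℚ) (M : ℕ)
           (ε≤e : ∀ m → M ℕ.≤ m → seq ε m ≤ e) where

    -- The two cuts have the same estimate X, which is eliminated at a common index of all the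
    -- sequences, at the cost of a slack δ from each inequality. The resulting bound increases with
    -- ε because c + c′ ≥ 0, so ε may be replaced by `e`.
    shared-sketch : ∀ {a b} → ι b * e ≡ ι a → ∀ ω G H →
      ApproximatesAllCuts sk est ε G ω → ApproximatesAllCuts sk est ε H ω → sk ω G ≡ sk ω H → Near a b G H
    shared-sketch {a} {b} be≡a ω G H G-ok H-ok eq S = ι-cancel-≤ (begin
      ι (b ℕ.* c)                           ≡⟨ ι-* b c ⟩
      ι b * ι c                             ≤⟨ *-monoˡ-≤-nonNeg (ι b) {{ι-nonNeg b}} (≤-from-slack slack) ⟩
      ι b * (ι c′ + e * (ι c + ι c′))       ≡⟨ expand (ι b) (ι c′) e (ι c + ι c′) ⟩
      ι b * ι c′ + ι b * e * (ι c + ι c′)   ≡⟨ cong₂ (λ s t → ι b * ι c′ + s * t) be≡a (sym (ι-+ c c′)) ⟩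
      ι b * ι c′ + ι a * ι (c ℕ.+ c′)       ≡⟨ cong₂ _+_ (sym (ι-* b c′)) (sym (ι-* a (c ℕ.+ c′))) ⟩
      ι (b ℕ.* c′) + ι (a ℕ.* (c ℕ.+ c′))   ≡⟨ ι-+ (b ℕ.* c′) (a ℕ.* (c ℕ.+ c′)) ⟨
      ι (b ℕ.* c′ ℕ.+ a ℕ.* (c ℕ.+ c′))     ∎)
      where
      open ≤-Reasoning
      c  = cutSize G S
      c′ = cutSize H S
      X  = est ω S (sk ω G)
      expand : ∀ b c e t → b * (c + e * t) ≡ b * c + b * e * t
      expand = solve 4 (λ b c e t → b :* (c :+ e :* t) := b :* c :+ b :* e :* t) refl
        where open +-*-Solver
      lower : (1ℝ -ℝ ε) *ℝ fromℕ c ≤ℝ X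
      lower = proj₁ (G-ok S)
      upper : X ≤ℝ (1ℝ +ℝ ε) *ℝ fromℕ c′
      upper = proj₂ (subst (λ σ → est ω S σ ∈[1± ε ]* fromℕ c′) (sym eq) (H-ok S))
      slack : ∀ δ → 0ℚ < δ → ι c ≤ ι c′ + e * (ι c + ι c′) + (δ + δ)
      slack δ 0<δ = begin
        ι c
          ≡⟨ split ε′ (ι c) ⟩
        (1ℚ - ε′) * ι c + ε′ * ι c
          ≤⟨ +-monoˡ-≤ (ε′ * ι c) (≤-trans (proj₂ (lower δ 0<δ) m N₁≤m) (+-monoˡ-≤ δ (proj₂ (upper δ 0<δ) m N₂≤m))) ⟩
        (1ℚ + ε′) * ι c′ + δ + δ + ε′ * ι c
          ≡⟨ regroup ε′ (ι c) (ι c′) δ ⟩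
        ι c′ + ε′ * (ι c + ι c′) + (δ + δ)
          ≤⟨ +-monoˡ-≤ (δ + δ) (+-monoʳ-≤ (ι c′) (*-monoʳ-≤-nonNeg (ι c + ι c′)
               {{subst NonNegative (ι-+ c c′) (ι-nonNeg (c ℕ.+ c′))}} (ε≤e m M≤m))) ⟩
        ι c′ + e * (ι c + ι c′) + (δ + δ) ∎
        where
        N₁ = proj₁ (lower δ 0<δ)
        N₂ = proj₁ (upper δ 0<δ)
        m = M ℕ.⊔ (N₁ ℕ.⊔ N₂)
        M≤m = ℕ.m≤m⊔n M (N₁ ℕ.⊔ N₂)
        N₁≤m = ℕ.≤-trans (ℕ.m≤m⊔n N₁ N₂) (ℕ.m≤n⊔m M (N₁ ℕ.⊔ N₂))
        N₂≤m = ℕ.≤-trans (ℕ.m≤n⊔m N₁ N₂) (ℕ.m≤n⊔m M (N₁ ℕ.⊔ N₂))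
        ε′ = seq ε m
        split : ∀ e c → c ≡ (1ℚ - e) * c + e * c
        split = solve 2 (λ e c → c := (con 1ℚ :- e) :* c :+ e :* c) refl
          where open +-*-Solver
        regroup : ∀ e c c′ δ → (1ℚ + e) * c′ + δ + δ + e * c ≡ c′ + e * (c + c′) + (δ + δ)
        regroup = solve 4 (λ e c c′ δ → (con 1ℚ :+ e) :* c′ :+ δ :+ δ :+ e :* c := c′ :+ e :* (c :+ c′) :+ (δ :+ δ)) refl
          where open +-*-Solver

    rational-bound : 0ℚ < e → e < 1ℚ → 1ℚ < ι n * (e * e) →
      (∀ G → Probability≥ (ℤ.+ 3 / 4) (ApproximatesAllCuts sk est ε G)) →
      ∀ s → WorstCaseSize≤ sk s → ι n ≤ ι size-constant * (ι s * (e * e))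
    rational-bound 0<e e<1 1<ne² likely s short =
      *-cancelʳ-≤-pos (ι b * ι b) {{pos*pos⇒pos (ι b) {{ι-pos 0<b}} (ι b) {{ι-pos 0<b}}}} (begin
      ι n * (ι b * ι b)                            ≡⟨ trans (ι-* n (b ℕ.* b)) (cong (ι n *_) (ι-* b b)) ⟨
      ι (n ℕ.* (b ℕ.* b))
        ≤⟨ ι-mono-≤ (Bounds.size-bound sk (ApproximatesAllCuts sk est ε) likely s short a b
             (shared-sketch {a} {b} be≡a) 0<a a<b b²<na²) ⟩
      ι (K ℕ.* (s ℕ.* (a ℕ.* a)))
        ≡⟨ trans (ι-* K (s ℕ.* (a ℕ.* a))) (cong (ι K *_) (trans (ι-* s (a ℕ.* a)) (cong (ι s *_) a²≡))) ⟩
      ι K * (ι s * (e * e * (ι b * ι b)))          ≡⟨ regroup (ι K) (ι s) (e * e) (ι b * ι b) ⟩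
      ι K * (ι s * (e * e)) * (ι b * ι b)          ∎)
      where
      open ≤-Reasoning
      ab = fraction e 0<e
      a = proj₁ ab
      b = proj₁ (proj₂ ab)
      0<a = proj₁ (proj₂ (proj₂ ab))
      0<b = proj₁ (proj₂ (proj₂ (proj₂ ab)))
      be≡a = proj₂ (proj₂ (proj₂ (proj₂ ab)))
      K = size-constant
      regroup : ∀ k s t u → k * (s * (t * u)) ≡ k * (s * t) * u
      regroup = solve 4 (λ k s t u → k :* (s :* (t :* u)) := k :* (s :* t) :* u) refl
        where open +-*-Solver
      square : ∀ b e → b * e * (b * e) ≡ e * e * (b * b)
      square = solve 2 (λ b e → b :* e :* (b :* e) := e :* e :* (b :* b)) refl
        where open +-*-Solver
      a²≡ : ι (a ℕ.* a) ≡ e * e * (ι b * ι b)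
      a²≡ = trans (ι-* a a) (trans (cong₂ _*_ (sym be≡a) (sym be≡a)) (square (ι b) e))
      a<b : a ℕ.< b
      a<b = ι-cancel-< (subst₂ _<_ be≡a (*-identityʳ (ι b)) (*-monoʳ-<-pos (ι b) {{ι-pos 0<b}} e<1))
      b²<na² : b ℕ.* b ℕ.< n ℕ.* (a ℕ.* a)
      b²<na² = ι-cancel-< (begin-strict
        ι (b ℕ.* b)                          ≡⟨ trans (ι-* b b) (sym (*-identityˡ (ι b * ι b))) ⟩
        1ℚ * (ι b * ι b)                     <⟨ *-monoˡ-<-pos (ι b * ι b) {{pos*pos⇒pos (ι b) {{ι-pos 0<b}} (ι b) {{ι-pos 0<b}}}} 1<ne² ⟩
        ι n * (e * e) * (ι b * ι b)          ≡⟨ *-assoc (ι n) (e * e) (ι b * ι b) ⟩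
        ι n * (e * e * (ι b * ι b))          ≡⟨ trans (ι-* n (a ℕ.* a)) (cong (ι n *_) a²≡) ⟨
        ι (n ℕ.* (a ℕ.* a))                  ∎)

  -- Used for the excess η of a rational e = x + η over a term x of ε: η < ζ keeps e below 1, and η
  -- ≤ δ keeps it within 2x.
  common-slack : ∀ δ ζ → 0ℚ < δ → 0ℚ < ζ → ∃ λ η → 0ℚ < η × η ≤ δ × η < ζ
  common-slack δ ζ 0<δ 0<ζ with ≤-total δ (½ * ζ)
  ... | inj₁ δ≤½ζ = δ , 0<δ , ≤-refl , ≤-<-trans δ≤½ζ (½*-< 0<ζ)
  ... | inj₂ ½ζ≤δ = ½ * ζ , ½-pos 0<ζ , ½ζ≤δ , ½*-< 0<ζ

  square-mono-≤ : ∀ {p q} → 0ℚ ≤ p → p ≤ q → p * p ≤ q * q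
  square-mono-≤ {p} {q} 0≤p p≤q = ≤-trans (*-monoˡ-≤-nonNeg p {{nonNegative 0≤p}} p≤q)
    (*-monoʳ-≤-nonNeg q {{nonNegative (≤-trans 0≤p p≤q)}} p≤q)

  κ : ℚ
  κ = ι size-constant

  instance
    κ-pos : Positive κ
    κ-pos = ι-pos (ℕ.≤-trans (s≤s z≤n) size-constant-large)

    κ-nonZero : NonZero κ
    κ-nonZero = pos⇒nonZero κ

  -- 1/(4κ), where 4 pays for passing from e² to x² with e ≤ 2x.
  rate : ℚ
  rate = ½ * ½ * (1/ κ)

  0<rate : 0ℚ < rate
  0<rate = subst (_< rate) (*-zeroʳ (½ * ½)) (*-monoʳ-<-pos (½ * ½) (positive⁻¹ (1/ κ) {{1/pos⇒pos κ}}))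

  rate-cancel : ∀ s x → rate * (κ * (s * ((x + x) * (x + x)))) ≡ s * (x * x)
  rate-cancel s x = begin
    ½ * ½ * (1/ κ) * (κ * (s * ((x + x) * (x + x))))                ≡⟨ regroup ½ (1/ κ) κ s x ⟩
    1/ κ * κ * (s * ((½ * x + ½ * x) * (½ * x + ½ * x)))            ≡⟨ cong₂ (λ t y → t * (s * (y * y))) (*-inverseˡ κ) (½+½ x) ⟩
    1ℚ * (s * (x * x))                                              ≡⟨ *-identityˡ (s * (x * x)) ⟩
    s * (x * x)                                                     ∎
    where
    open ≡-Reasoning
    regroup : ∀ h r k s x → h * h * r * (k * (s * ((x + x) * (x + x)))) ≡ r * k * (s * ((h * x + h * x) * (h * x + h * x)))
    regroup = solve 5 (λ h r k s x → h :* h :* r :* (k :* (s :* ((x :+ x) :* (x :+ x)))) :=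
      r :* k :* (s :* ((h :* x :+ h :* x) :* (h :* x :+ h :* x)))) refl
      where open +-*-Solver

open import Defs
open import Data.Nat as ℕ using (ℕ)
import Data.Nat.Properties as ℕ
open import Data.Integer using (+_)
open import Data.Rational
open import Data.Rational.Properties
open import Data.Product using (∃; _×_; _,_)
open import Relation.Binary.PropositionalEquality using (subst)
open CoinSelection using (ι; ∣p-q∣≤r⇒p≤q+r)
open RealBound

theorem3p1 : ∃ λ (c : ℝ) → (0ℝ <ℝ c) ×
    ((n : ℕ) (ε : ℝ) →
    0ℝ <ℝ ε →
    1ℝ <ℝ fromℕ n *ℝ (ε *ℝ ε) →
    ε <ℝ 1ℝ →
    (sk : SketchAlg n) (est : EstimateAlg n) →
    ((G : Graph n) → Probability≥ (+ 3 / 4) (ApproximatesAllCuts sk est ε G)) →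
    (s : ℕ) → WorstCaseSize≤ sk s →
    c *ℝ fromℕ n ≤ℝ fromℕ s *ℝ (ε *ℝ ε))
theorem3p1 = fromℚ rate , (rate , 0<rate , 0 , λ _ _ → ≤-reflexive (+-identityˡ rate)) ,
  λ n ε (δ₀ , 0<δ₀ , N₀ , δ₀≤ε) (δ₁ , 0<δ₁ , N₁ , 1+δ₁≤nε²) (δ₂ , 0<δ₂ , N₂ , ε+δ₂≤1) sk est likely s short δ 0<δ →
  let η , 0<η , η≤δ₀ , η<δ₂ = common-slack δ₀ δ₂ 0<δ₀ 0<δ₂
      N₃ , ε-cauchy = cauchy ε η 0<η
  in N₀ ℕ.⊔ (N₁ ℕ.⊔ (N₂ ℕ.⊔ N₃)) , λ m N≤m →
  let open ≤-Reasoning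
      N₁₂₃≤m = ℕ.m⊔n≤o⇒n≤o N₀ _ N≤m
      N₂₃≤m  = ℕ.m⊔n≤o⇒n≤o N₁ _ N₁₂₃≤m
      x = seq ε m
      -- A separate rational upper bound of ε for every index `m`; the loss against `x` is a
      -- constant factor, so the rate is the same for all of them.
      e = x + η
      δ₀≤x : δ₀ ≤ x
      δ₀≤x = subst (_≤ x) (+-identityˡ δ₀) (δ₀≤ε m (ℕ.m⊔n≤o⇒m≤o N₀ _ N≤m))
      0≤x : 0ℚ ≤ x
      0≤x = ≤-trans (<⇒≤ 0<δ₀) δ₀≤x
      x≤e : x ≤ e
      x≤e = subst (_≤ e) (+-identityʳ x) (+-monoʳ-≤ x (<⇒≤ 0<η))
      0<e : 0ℚ < e
      0<e = <-≤-trans 0<δ₀ (≤-trans δ₀≤x x≤e)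
      e<1 : e < 1ℚ
      e<1 = <-≤-trans (+-monoʳ-< x η<δ₂) (ε+δ₂≤1 m (ℕ.m⊔n≤o⇒m≤o N₂ _ N₂₃≤m))
      1<ne² : 1ℚ < ι n * (e * e)
      1<ne² = <-≤-trans (subst (_< 1ℚ + δ₁) (+-identityʳ 1ℚ) (+-monoʳ-< 1ℚ 0<δ₁))
        (≤-trans (1+δ₁≤nε² m (ℕ.m⊔n≤o⇒m≤o N₁ _ N₁₂₃≤m))
          (*-monoˡ-≤-nonNeg (ι n) {{ι-nonNeg n}} (square-mono-≤ 0≤x x≤e)))
      ε≤e : ∀ k → N₃ ℕ.≤ k → seq ε k ≤ e
      ε≤e k N₃≤k = ∣p-q∣≤r⇒p≤q+r (seq ε k) x (ε-cauchy k m N₃≤k (ℕ.m⊔n≤o⇒n≤o N₂ _ N₂₃≤m))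
      e²≤4x² : e * e ≤ (x + x) * (x + x)
      e²≤4x² = square-mono-≤ (<⇒≤ 0<e) (+-monoʳ-≤ x (≤-trans η≤δ₀ δ₀≤x))
  in begin
    rate * ι n
      ≤⟨ *-monoˡ-≤-nonNeg rate {{nonNegative (<⇒≤ 0<rate)}}
           (rational-bound sk est ε e N₃ ε≤e 0<e e<1 1<ne² likely s short) ⟩
    rate * (κ * (ι s * (e * e)))
      ≤⟨ *-monoˡ-≤-nonNeg rate {{nonNegative (<⇒≤ 0<rate)}}
           (*-monoˡ-≤-nonNeg κ {{pos⇒nonNeg κ}} (*-monoˡ-≤-nonNeg (ι s) {{ι-nonNeg s}} e²≤4x²)) ⟩
    rate * (κ * (ι s * ((x + x) * (x + x))))
      ≡⟨ rate-cancel (ι s) x ⟩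
    ι s * (x * x)
      ≡⟨ +-identityʳ (ι s * (x * x)) ⟨
    ι s * (x * x) + 0ℚ
      ≤⟨ +-monoʳ-≤ (ι s * (x * x)) (<⇒≤ 0<δ) ⟩
    ι s * (x * x) + δ ∎
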